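{- For every integer $k\ge7$, $c_{n_k^*}\ge\frac14+\frac{1}{8(n_k^*)^{2/3}-4}$, where $$n_k^*=2k+2\sum_{i=1}^{\lfloor\sqrt{k/2}\rfloor}\left(2\left\lfloor\frac{2k-2i^2-i}{2}\right\rfloor+i\right).$$
   Context: A weighted digraph $D=(V,A,w)$ is a digraph without loops or parallel arcs (opposite arcs allowed) with weights $w:A\to\mathbb{R}_{\ge0}$; $w(D)$ is the total arc weight. For a partition $(X,Y)$ of $V$, $w(X,Y)$ is the total weight of arcs from $X$ to $Y$, and $\mathrm{mac}(D)=\max_{(X,Y)}w(X,Y)$. For an integer $\nu\ge1$, $c_\nu$ is the supremum of reals $c\ge0$ such that every acyclic weighted digraph $D$ whose longest directed path has exactly $\nu$ vertices satisfies $\mathrm{mac}(D)\ge c\cdot w(D)$. -}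

module Defs where

open import Data.Bool.Base using (Bool; true; false; T; _∧_; if_then_else_)
open import Data.Empty using (⊥-elim)
open import Data.Fin.Base using (Fin)
open import Data.Fin.Subset using (Subset; inside; outside; ∁)
open import Data.Integer.Base using (+_)
import Data.Integer.Base as ℤ
import Data.Integer.Properties as ℤ
open import Data.List.Base using (List; []; _∷_; _∷ʳ_; length; applyUpTo)
open import Data.List.Relation.Unary.Linked using (Linked)
open import Data.List.Relation.Unary.Unique.Propositional using (Unique)
open import Data.Nat.Base as ℕ using (ℕ; zero; suc; z≤n; s≤s)
import Data.Nat.DivMod as ℕ
open import Data.Nat.ListAction using (sum)
import Data.Nat.Properties as ℕ
open import Data.Product.Base using (∃-syntax; _×_; _,_)
open import Data.Rational.Base as ℚ using (ℚ; 0ℚ; 1ℚ; ½; ∣_∣)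
import Data.Rational.Properties as ℚ
import Data.Rational.Unnormalised.Base as ℚᵘ
import Data.Rational.Unnormalised.Properties as ℚᵘ
open import Data.Rational.Solver using (module +-*-Solver)
open import Data.Nat.Solver renaming (module +-*-Solver to ℕ-Solver)
open import Data.Sum.Base using (inj₁; inj₂)
open import Data.Unit.Base using (tt)
open import Data.Vec.Base using ([]; _∷_; lookup)
import Data.Vec.Functional as Vector
open import Relation.Binary.PropositionalEquality
  using (_≡_; refl; sym; trans; cong; cong₂; subst)
open import Relation.Nullary.Decidable.Core using (yes; no)
open import Relation.Nullary.Negation.Core using (¬_)
open import Relation.Unary using (Pred; Decidable)
open import Level using (0ℓ)

-- Real numbers as Cauchy sequences of rationals (with modulus).  They
-- form a setoid under _≃_.

IsCauchy : (ℕ → ℚ) → Set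
IsCauchy s = ∀ ε → 0ℚ ℚ.< ε →
  ∃[ N ] (∀ m n → N ℕ.≤ m → N ℕ.≤ n → ∣ s m ℚ.- s n ∣ ℚ.< ε)

record ℝ : Set where
  constructor mkℝ
  field
    seq    : ℕ → ℚ
    cauchy : IsCauchy seq

open ℝ public

infix 4 _≤_ _<_ _≃_

_≤_ : ℝ → ℝ → Set
x ≤ y = ∀ ε → 0ℚ ℚ.< ε →
  ∃[ N ] (∀ n → N ℕ.≤ n → seq x n ℚ.≤ seq y n ℚ.+ ε)

_<_ : ℝ → ℝ → Set
x < y = ∃[ ε ] (0ℚ ℚ.< ε ×
  ∃[ N ] (∀ n → N ℕ.≤ n → seq x n ℚ.+ ε ℚ.≤ seq y n))

_≃_ : ℝ → ℝ → Set
x ≃ y = x ≤ y × y ≤ x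

half-sum : ∀ ε → ½ ℚ.* ε ℚ.+ ½ ℚ.* ε ≡ ε
half-sum ε = trans (sym (ℚ.*-distribʳ-+ ε ½ ½)) (ℚ.*-identityˡ ε)

pos* : ∀ {p q} → 0ℚ ℚ.< p → 0ℚ ℚ.< q → 0ℚ ℚ.< p ℚ.* q
pos* {p} {q} 0<p 0<q = ℚ.positive⁻¹ (p ℚ.* q)
  {{ℚ.pos*pos⇒pos p {{ℚ.positive 0<p}} q {{ℚ.positive 0<q}}}}

0<½ : 0ℚ ℚ.< ½
0<½ = ℚ.positive⁻¹ ½

0<1 : 0ℚ ℚ.< 1ℚ
0<1 = ℚ.positive⁻¹ 1ℚ

half-pos : ∀ {ε} → 0ℚ ℚ.< ε → 0ℚ ℚ.< ½ ℚ.* ε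
half-pos = pos* 0<½

half-< : ∀ {ε} → 0ℚ ℚ.< ε → ½ ℚ.* ε ℚ.< ε
half-< {ε} 0<ε = begin-strict
  ½ ℚ.* ε                 ≡⟨ ℚ.+-identityˡ _ ⟨
  0ℚ ℚ.+ ½ ℚ.* ε          <⟨ ℚ.+-monoˡ-< (½ ℚ.* ε) (half-pos 0<ε) ⟩
  ½ ℚ.* ε ℚ.+ ½ ℚ.* ε     ≡⟨ half-sum ε ⟩
  ε                       ∎
  where open ℚ.≤-Reasoning

*-mono-≤ : ∀ {p q r s} → 0ℚ ℚ.≤ p → 0ℚ ℚ.≤ s → p ℚ.≤ q → r ℚ.≤ s →
           p ℚ.* r ℚ.≤ q ℚ.* s
*-mono-≤ {p} {q} {r} {s} 0≤p 0≤s p≤q r≤s = ℚ.≤-trans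
  (ℚ.*-monoˡ-≤-nonNeg p {{ℚ.nonNegative 0≤p}} r≤s)
  (ℚ.*-monoʳ-≤-nonNeg s {{ℚ.nonNegative 0≤s}} p≤q)

∣-∣-swap : ∀ p q → ∣ p ℚ.- q ∣ ≡ ∣ q ℚ.- p ∣
∣-∣-swap p q = trans (cong ∣_∣ (solve 2 (λ a b → a :- b := :- (b :- a)) refl p q))
                     (ℚ.∣-p∣≡∣p∣ (q ℚ.- p))
  where open +-*-Solver

p≤∣p∣ : ∀ p → p ℚ.≤ ∣ p ∣
p≤∣p∣ p with ℚ.≤-total 0ℚ p
... | inj₁ 0≤p = ℚ.≤-reflexive (sym (ℚ.0≤p⇒∣p∣≡p 0≤p))
... | inj₂ p≤0 = ℚ.≤-trans p≤0 (ℚ.0≤∣p∣ p)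

∣p∣<ε : ∀ {p ε} → p ℚ.< ε → ℚ.- p ℚ.< ε → ∣ p ∣ ℚ.< ε
∣p∣<ε {p} p<ε -p<ε with ℚ.∣p∣≡p∨∣p∣≡-p p
... | inj₁ eq = subst (ℚ._< _) (sym eq) p<ε
... | inj₂ eq = subst (ℚ._< _) (sym eq) -p<ε

-<⇒<+ : ∀ {p q ε} → p ℚ.- q ℚ.< ε → p ℚ.< q ℚ.+ ε
-<⇒<+ {p} {q} {ε} h = subst (ℚ._< q ℚ.+ ε)
  (solve 2 (λ a b → b :+ (a :- b) := a) refl p q) (ℚ.+-monoʳ-< q h)
  where open +-*-Solver

<+⇒-< : ∀ {p q ε} → p ℚ.< q ℚ.+ ε → p ℚ.- q ℚ.< ε
<+⇒-< {p} {q} {ε} h = subst (p ℚ.- q ℚ.<_)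
  (solve 2 (λ b e → (b :+ e) :- b := e) refl q ε) (ℚ.+-monoˡ-< (ℚ.- q) h)
  where open +-*-Solver

close : ∀ {p q ε} → p ℚ.< q ℚ.+ ε → q ℚ.< p ℚ.+ ε → ∣ p ℚ.- q ∣ ℚ.< ε
close {p} {q} {ε} h₁ h₂ = ∣p∣<ε (<+⇒-< h₁) (subst (ℚ._< ε)
  (solve 2 (λ a b → b :- a := :- (a :- b)) refl p q) (<+⇒-< h₂))
  where open +-*-Solver

close⁻ : ∀ {p q ε} → ∣ p ℚ.- q ∣ ℚ.< ε → p ℚ.< q ℚ.+ ε
close⁻ {p} {q} h = -<⇒<+ {p} {q} (ℚ.≤-<-trans (p≤∣p∣ _) h)

inv : ℚ → ℚ
inv q with q ℚ.≟ 0ℚ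
... | yes _   = 0ℚ
... | no  q≢0 = (ℚ.1/ q) {{ℚ.≢-nonZero q≢0}}

inv-cancel : ∀ {q} → 0ℚ ℚ.< q → q ℚ.* inv q ≡ 1ℚ
inv-cancel {q} 0<q with q ℚ.≟ 0ℚ
... | yes refl = ⊥-elim (ℚ.<-irrefl refl 0<q)
... | no  q≢0  = ℚ.*-inverseʳ q {{ℚ.≢-nonZero q≢0}}

inv-pos : ∀ {q} → 0ℚ ℚ.< q → 0ℚ ℚ.< inv q
inv-pos {q} 0<q with q ℚ.≟ 0ℚ
... | yes refl = ⊥-elim (ℚ.<-irrefl refl 0<q)
... | no  q≢0  = ℚ.positive⁻¹ _ {{ℚ.1/pos⇒pos q {{ℚ.positive 0<q}}}}

inv-anti : ∀ {p q} → 0ℚ ℚ.< p → p ℚ.≤ q → inv q ℚ.≤ inv p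
inv-anti {p} {q} 0<p p≤q = begin
  inv q                       ≡⟨ ℚ.*-identityʳ _ ⟨
  inv q ℚ.* 1ℚ                ≡⟨ cong (inv q ℚ.*_) (inv-cancel 0<p) ⟨
  inv q ℚ.* (p ℚ.* inv p)     ≤⟨ ℚ.*-monoˡ-≤-nonNeg (inv q) {{ℚ.nonNegative (ℚ.<⇒≤ (inv-pos 0<q))}}
                                   (ℚ.*-monoʳ-≤-nonNeg (inv p) {{ℚ.nonNegative (ℚ.<⇒≤ (inv-pos 0<p))}} p≤q) ⟩
  inv q ℚ.* (q ℚ.* inv p)     ≡⟨ solve 3 (λ a b c → a :* (b :* c) := (b :* a) :* c) refl (inv q) q (inv p) ⟩
  (q ℚ.* inv q) ℚ.* inv p     ≡⟨ cong (ℚ._* inv p) (inv-cancel 0<q) ⟩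
  1ℚ ℚ.* inv p                ≡⟨ ℚ.*-identityˡ _ ⟩
  inv p                       ∎
  where
  open ℚ.≤-Reasoning
  open +-*-Solver
  0<q = ℚ.<-≤-trans 0<p p≤q

scale : ℚ → ℚ → ℚ
scale B ε = (½ ℚ.* ε) ℚ.* inv B

scale-pos : ∀ {B ε} → 0ℚ ℚ.< B → 0ℚ ℚ.< ε → 0ℚ ℚ.< scale B ε
scale-pos 0<B 0<ε = pos* (half-pos 0<ε) (inv-pos 0<B)

scale-bound : ∀ {B ε a d} → 0ℚ ℚ.< B → a ℚ.≤ B → 0ℚ ℚ.≤ d → d ℚ.< scale B ε →
              a ℚ.* d ℚ.< ½ ℚ.* ε
scale-bound {B} {ε} {a} {d} 0<B a≤B 0≤d d< = begin-strict
  a ℚ.* d                         ≤⟨ ℚ.*-monoʳ-≤-nonNeg d {{ℚ.nonNegative 0≤d}} a≤B ⟩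
  B ℚ.* d                         <⟨ ℚ.*-monoʳ-<-pos B {{ℚ.positive 0<B}} d< ⟩
  B ℚ.* ((½ ℚ.* ε) ℚ.* inv B)     ≡⟨ solve 3 (λ b e i → b :* (e :* i) := (b :* i) :* e) refl B (½ ℚ.* ε) (inv B) ⟩
  (B ℚ.* inv B) ℚ.* (½ ℚ.* ε)     ≡⟨ cong (ℚ._* (½ ℚ.* ε)) (inv-cancel 0<B) ⟩
  1ℚ ℚ.* (½ ℚ.* ε)                ≡⟨ ℚ.*-identityˡ _ ⟩
  ½ ℚ.* ε                         ∎
  where
  open ℚ.≤-Reasoning
  open +-*-Solver

bounded : ∀ x → ∃[ B ] (0ℚ ℚ.< B × ∃[ N ] (∀ n → N ℕ.≤ n → ∣ seq x n ∣ ℚ.≤ B))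
bounded x with cauchy x 1ℚ 0<1
... | N , h = B , ℚ.<-≤-trans 0<1 1≤B , N , bd
  where
  open ℚ.≤-Reasoning
  open +-*-Solver
  xN = seq x N
  B = 1ℚ ℚ.+ ∣ xN ∣
  1≤B : 1ℚ ℚ.≤ B
  1≤B = ℚ.≤-trans (ℚ.≤-reflexive (sym (ℚ.+-identityʳ 1ℚ))) (ℚ.+-monoʳ-≤ 1ℚ (ℚ.0≤∣p∣ xN))
  bd : ∀ n → N ℕ.≤ n → ∣ seq x n ∣ ℚ.≤ B
  bd n N≤n = begin
    ∣ seq x n ∣                          ≡⟨ cong ∣_∣ (solve 2 (λ a b → a := (a :- b) :+ b) refl (seq x n) xN) ⟩
    ∣ (seq x n ℚ.- xN) ℚ.+ xN ∣          ≤⟨ ℚ.∣p+q∣≤∣p∣+∣q∣ (seq x n ℚ.- xN) xN ⟩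
    ∣ seq x n ℚ.- xN ∣ ℚ.+ ∣ xN ∣        ≤⟨ ℚ.+-monoˡ-≤ ∣ xN ∣ (ℚ.<⇒≤ (h n N N≤n ℕ.≤-refl)) ⟩
    B                                    ∎

product-close : ∀ {a b c d B C ε} → 0ℚ ℚ.< B → 0ℚ ℚ.< C →
  ∣ a ∣ ℚ.≤ B → ∣ d ∣ ℚ.≤ C →
  ∣ b ℚ.- d ∣ ℚ.< scale B ε → ∣ a ℚ.- c ∣ ℚ.< scale C ε →
  ∣ a ℚ.* b ℚ.- c ℚ.* d ∣ ℚ.< ε
product-close {a} {b} {c} {d} {B} {C} {ε} 0<B 0<C a≤B d≤C bd ac = begin-strict
  ∣ a ℚ.* b ℚ.- c ℚ.* d ∣
    ≡⟨ cong ∣_∣ (solve 4 (λ a b c d → a :* b :- c :* d := a :* (b :- d) :+ d :* (a :- c)) refl a b c d) ⟩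
  ∣ a ℚ.* (b ℚ.- d) ℚ.+ d ℚ.* (a ℚ.- c) ∣
    ≤⟨ ℚ.∣p+q∣≤∣p∣+∣q∣ (a ℚ.* (b ℚ.- d)) (d ℚ.* (a ℚ.- c)) ⟩
  ∣ a ℚ.* (b ℚ.- d) ∣ ℚ.+ ∣ d ℚ.* (a ℚ.- c) ∣
    ≡⟨ cong₂ ℚ._+_ (ℚ.∣p*q∣≡∣p∣*∣q∣ a (b ℚ.- d)) (ℚ.∣p*q∣≡∣p∣*∣q∣ d (a ℚ.- c)) ⟩
  ∣ a ∣ ℚ.* ∣ b ℚ.- d ∣ ℚ.+ ∣ d ∣ ℚ.* ∣ a ℚ.- c ∣
    <⟨ ℚ.+-mono-< {∣ a ∣ ℚ.* ∣ b ℚ.- d ∣} {½ ℚ.* ε} {∣ d ∣ ℚ.* ∣ a ℚ.- c ∣} {½ ℚ.* ε}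
         (scale-bound {B} {ε} {∣ a ∣} 0<B a≤B (ℚ.0≤∣p∣ (b ℚ.- d)) bd)
         (scale-bound {C} {ε} {∣ d ∣} 0<C d≤C (ℚ.0≤∣p∣ (a ℚ.- c)) ac) ⟩
  ½ ℚ.* ε ℚ.+ ½ ℚ.* ε
    ≡⟨ half-sum ε ⟩
  ε ∎
  where
  open ℚ.≤-Reasoning
  open +-*-Solver

fromℚ : ℚ → ℝ
fromℚ q = mkℝ (λ _ → q) λ ε 0<ε → 0 , λ _ _ _ _ →
  subst (ℚ._< ε) (cong ∣_∣ (sym (ℚ.+-inverseʳ q))) 0<ε

0ℝ : ℝ
0ℝ = fromℚ 0ℚ

infixl 6 _+_ _-_ _⊔_
infixl 7 _*_
infix  8 -_

_+_ : ℝ → ℝ → ℝ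
x + y = mkℝ (λ n → seq x n ℚ.+ seq y n) c
  where
  open ℚ.≤-Reasoning
  open +-*-Solver
  c : IsCauchy (λ n → seq x n ℚ.+ seq y n)
  c ε 0<ε with cauchy x (½ ℚ.* ε) (half-pos 0<ε) | cauchy y (½ ℚ.* ε) (half-pos 0<ε)
  ... | N₁ , h₁ | N₂ , h₂ = N₁ ℕ.⊔ N₂ , λ m n N≤m N≤n → begin-strict
    ∣ (seq x m ℚ.+ seq y m) ℚ.- (seq x n ℚ.+ seq y n) ∣
      ≡⟨ cong ∣_∣ (solve 4 (λ a b c d → (a :+ b) :- (c :+ d) := (a :- c) :+ (b :- d)) refl
           (seq x m) (seq y m) (seq x n) (seq y n)) ⟩
    ∣ (seq x m ℚ.- seq x n) ℚ.+ (seq y m ℚ.- seq y n) ∣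
      ≤⟨ ℚ.∣p+q∣≤∣p∣+∣q∣ (seq x m ℚ.- seq x n) (seq y m ℚ.- seq y n) ⟩
    ∣ seq x m ℚ.- seq x n ∣ ℚ.+ ∣ seq y m ℚ.- seq y n ∣
      <⟨ ℚ.+-mono-< (h₁ m n (ℕ.m⊔n≤o⇒m≤o N₁ N₂ N≤m) (ℕ.m⊔n≤o⇒m≤o N₁ N₂ N≤n))
                    (h₂ m n (ℕ.m⊔n≤o⇒n≤o N₁ N₂ N≤m) (ℕ.m⊔n≤o⇒n≤o N₁ N₂ N≤n)) ⟩
    ½ ℚ.* ε ℚ.+ ½ ℚ.* ε
      ≡⟨ half-sum ε ⟩
    ε ∎

-_ : ℝ → ℝ
- x = mkℝ (λ n → ℚ.- seq x n) c
  where
  open +-*-Solver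
  c : IsCauchy (λ n → ℚ.- seq x n)
  c ε 0<ε with cauchy x ε 0<ε
  ... | N , h = N , λ m n N≤m N≤n → subst (ℚ._< ε)
    (cong ∣_∣ (solve 2 (λ a b → a :- b := :- b :- :- a) refl (seq x n) (seq x m)))
    (h n m N≤n N≤m)

_-_ : ℝ → ℝ → ℝ
x - y = x + - y

_*_ : ℝ → ℝ → ℝ
x * y = mkℝ (λ n → seq x n ℚ.* seq y n) c
  where
  c : IsCauchy (λ n → seq x n ℚ.* seq y n)
  c ε 0<ε =
    let Bx , 0<Bx , Mx , bx = bounded x
        By , 0<By , My , by = bounded y
        Nx , hx = cauchy x (scale By ε) (scale-pos 0<By 0<ε)
        Ny , hy = cauchy y (scale Bx ε) (scale-pos 0<Bx 0<ε)
    in (Mx ℕ.⊔ My) ℕ.⊔ (Nx ℕ.⊔ Ny) , λ m n N≤m N≤n →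
    let Mm = ℕ.m⊔n≤o⇒m≤o (Mx ℕ.⊔ My) (Nx ℕ.⊔ Ny) N≤m
        Mn = ℕ.m⊔n≤o⇒m≤o (Mx ℕ.⊔ My) (Nx ℕ.⊔ Ny) N≤n
        Nm = ℕ.m⊔n≤o⇒n≤o (Mx ℕ.⊔ My) (Nx ℕ.⊔ Ny) N≤m
        Nn = ℕ.m⊔n≤o⇒n≤o (Mx ℕ.⊔ My) (Nx ℕ.⊔ Ny) N≤n
    in product-close {seq x m} {seq y m} {seq x n} {seq y n} 0<Bx 0<By
         (bx m (ℕ.m⊔n≤o⇒m≤o Mx My Mm)) (by n (ℕ.m⊔n≤o⇒n≤o Mx My Mn))
         (hy m n (ℕ.m⊔n≤o⇒n≤o Nx Ny Nm) (ℕ.m⊔n≤o⇒n≤o Nx Ny Nn))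
         (hx m n (ℕ.m⊔n≤o⇒m≤o Nx Ny Nm) (ℕ.m⊔n≤o⇒m≤o Nx Ny Nn))

_⊔_ : ℝ → ℝ → ℝ
x ⊔ y = mkℝ (λ n → seq x n ℚ.⊔ seq y n) c
  where
  open ℚ.≤-Reasoning
  below : ∀ {p q r s ε} → p ℚ.< r ℚ.+ ε → q ℚ.< s ℚ.+ ε → p ℚ.⊔ q ℚ.< (r ℚ.⊔ s) ℚ.+ ε
  below {p} {q} {r} {s} {ε} p< q< with ℚ.≤-total p q
  ... | inj₁ p≤q = subst (ℚ._< _) (sym (ℚ.p≤q⇒p⊔q≡q p≤q))
                     (ℚ.<-≤-trans q< (ℚ.+-monoˡ-≤ ε (ℚ.p≤q⊔p r s)))
  ... | inj₂ q≤p = subst (ℚ._< _) (sym (ℚ.p≥q⇒p⊔q≡p q≤p))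
                     (ℚ.<-≤-trans p< (ℚ.+-monoˡ-≤ ε (ℚ.p≤p⊔q r s)))
  c : IsCauchy (λ n → seq x n ℚ.⊔ seq y n)
  c ε 0<ε with cauchy x ε 0<ε | cauchy y ε 0<ε
  ... | N₁ , h₁ | N₂ , h₂ = N₁ ℕ.⊔ N₂ , λ m n N≤m N≤n →
    let m₁ = ℕ.m⊔n≤o⇒m≤o N₁ N₂ N≤m ; n₁ = ℕ.m⊔n≤o⇒m≤o N₁ N₂ N≤n
        m₂ = ℕ.m⊔n≤o⇒n≤o N₁ N₂ N≤m ; n₂ = ℕ.m⊔n≤o⇒n≤o N₁ N₂ N≤n
        xm = seq x m ; xn = seq x n ; ym = seq y m ; yn = seq y n
    in close {xm ℚ.⊔ ym} {xn ℚ.⊔ yn}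
         (below {xm} {ym} {xn} {yn} (close⁻ {xm} {xn} (h₁ m n m₁ n₁)) (close⁻ {ym} {yn} (h₂ m n m₂ n₂)))
         (below {xn} {yn} {xm} {ym} (close⁻ {xn} {xm} (h₁ n m n₁ m₁)) (close⁻ {yn} {ym} (h₂ n m n₂ m₂)))

-- The inverse of x is the sequence of the 1 / xₙ, with 0 in place of the
-- (finitely many, as 0 < x) terms where xₙ = 0.
recip : (x : ℝ) → 0ℝ < x → ℝ
recip x (δ , 0<δ , M , pos) = mkℝ (λ n → inv (seq x n)) c
  where
  open ℚ.≤-Reasoning
  open +-*-Solver
  D = inv δ ℚ.* inv δ
  0<D : 0ℚ ℚ.< D
  0<D = pos* (inv-pos 0<δ) (inv-pos 0<δ)
  δ≤ : ∀ n → M ℕ.≤ n → δ ℚ.≤ seq x n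
  δ≤ n M≤n = subst (ℚ._≤ seq x n) (ℚ.+-identityˡ δ) (pos n M≤n)
  diff : ∀ {a b} → δ ℚ.≤ a → δ ℚ.≤ b →
         ∣ inv a ℚ.- inv b ∣ ≡ (inv a ℚ.* inv b) ℚ.* ∣ a ℚ.- b ∣
  diff {a} {b} δ≤a δ≤b = begin-equality
    ∣ inv a ℚ.- inv b ∣
      ≡⟨ cong ∣_∣ (cong₂ ℚ._-_ (sym (ℚ.*-identityˡ (inv a))) (sym (ℚ.*-identityˡ (inv b)))) ⟩
    ∣ 1ℚ ℚ.* inv a ℚ.- 1ℚ ℚ.* inv b ∣
      ≡⟨ cong₂ (λ s t → ∣ s ℚ.* inv a ℚ.- t ℚ.* inv b ∣) (sym (inv-cancel 0<b)) (sym (inv-cancel 0<a)) ⟩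
    ∣ (b ℚ.* inv b) ℚ.* inv a ℚ.- (a ℚ.* inv a) ℚ.* inv b ∣
      ≡⟨ cong ∣_∣ (solve 4 (λ a b i j → (b :* j) :* i :- (a :* i) :* j := (i :* j) :* (b :- a)) refl a b (inv a) (inv b)) ⟩
    ∣ (inv a ℚ.* inv b) ℚ.* (b ℚ.- a) ∣
      ≡⟨ ℚ.∣p*q∣≡∣p∣*∣q∣ (inv a ℚ.* inv b) (b ℚ.- a) ⟩
    ∣ inv a ℚ.* inv b ∣ ℚ.* ∣ b ℚ.- a ∣
      ≡⟨ cong₂ ℚ._*_ (ℚ.0≤p⇒∣p∣≡p (ℚ.<⇒≤ (pos* (inv-pos 0<a) (inv-pos 0<b)))) (∣-∣-swap b a) ⟩
    (inv a ℚ.* inv b) ℚ.* ∣ a ℚ.- b ∣ ∎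
    where
    0<a = ℚ.<-≤-trans 0<δ δ≤a
    0<b = ℚ.<-≤-trans 0<δ δ≤b
  near : ∀ {a b ε} → 0ℚ ℚ.< ε → δ ℚ.≤ a → δ ℚ.≤ b → ∣ a ℚ.- b ∣ ℚ.< scale D ε →
         ∣ inv a ℚ.- inv b ∣ ℚ.< ε
  near {a} {b} {ε} 0<ε δ≤a δ≤b h = begin-strict
    ∣ inv a ℚ.- inv b ∣
      ≡⟨ diff δ≤a δ≤b ⟩
    (inv a ℚ.* inv b) ℚ.* ∣ a ℚ.- b ∣
      <⟨ scale-bound {D} {ε} {inv a ℚ.* inv b} 0<D
           (*-mono-≤ {inv a} {inv δ} {inv b} {inv δ} (ℚ.<⇒≤ (inv-pos (ℚ.<-≤-trans 0<δ δ≤a)))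
             (ℚ.<⇒≤ (inv-pos 0<δ)) (inv-anti 0<δ δ≤a) (inv-anti 0<δ δ≤b))
           (ℚ.0≤∣p∣ (a ℚ.- b)) h ⟩
    ½ ℚ.* ε
      <⟨ half-< 0<ε ⟩
    ε ∎
  c : IsCauchy (λ n → inv (seq x n))
  c ε 0<ε with cauchy x (scale D ε) (scale-pos 0<D 0<ε)
  ... | N , h = M ℕ.⊔ N , λ m n N≤m N≤n →
    near 0<ε (δ≤ m (ℕ.m⊔n≤o⇒m≤o M N N≤m)) (δ≤ n (ℕ.m⊔n≤o⇒m≤o M N N≤n))
      (h m n (ℕ.m⊔n≤o⇒n≤o M N N≤m) (ℕ.m⊔n≤o⇒n≤o M N N≤n))

-- The greatest m ≤ b satisfying P, or 0 if there is none.
greatest : {P : Pred ℕ 0ℓ} → Decidable P → ℕ → ℕ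
greatest P? zero = zero
greatest P? (suc b) with P? (suc b)
... | yes _ = suc b
... | no  _ = greatest P? b

greatest-holds : {P : Pred ℕ 0ℓ} (P? : Decidable P) → P 0 → ∀ b → P (greatest P? b)
greatest-holds P? p0 zero = p0
greatest-holds P? p0 (suc b) with P? (suc b)
... | yes p = p
... | no  _ = greatest-holds P? p0 b

greatest-max : {P : Pred ℕ 0ℓ} (P? : Decidable P) → ∀ b {m} → P m → m ℕ.≤ b →
               m ℕ.≤ greatest P? b
greatest-max P? zero pm m≤b = m≤b
greatest-max P? (suc b) pm m≤1+b with P? (suc b) | ℕ.m≤n⇒m<n∨m≡n m≤1+b
... | yes _ | _          = m≤1+b
... | no ¬p | inj₁ m<1+b = greatest-max P? b pm (ℕ.≤-pred m<1+b)
... | no ¬p | inj₂ refl  = ⊥-elim (¬p pm)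

⌊√_/2⌋ : ℕ → ℕ
⌊√ k /2⌋ = greatest (λ m → 2 ℕ.* m ℕ.^ 2 ℕ.≤? k) k

⌊∛_⌋ : ℕ → ℕ
⌊∛ m ⌋ = greatest (λ a → a ℕ.^ 3 ℕ.≤? m) m

m≤m^3 : ∀ m → m ℕ.≤ m ℕ.^ 3
m≤m^3 zero    = z≤n
m≤m^3 (suc m) = ℕ.m≤m*n (suc m) (suc m ℕ.^ 2) {{ℕ.m^n≢0 (suc m) 2}}

⌊∛⌋-≤ : ∀ m → ⌊∛ m ⌋ ℕ.^ 3 ℕ.≤ m
⌊∛⌋-≤ m = greatest-holds (λ a → a ℕ.^ 3 ℕ.≤? m) z≤n m

⌊∛⌋-max : ∀ m {a} → a ℕ.^ 3 ℕ.≤ m → a ℕ.≤ ⌊∛ m ⌋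
⌊∛⌋-max m {a} a³≤m = greatest-max (λ a → a ℕ.^ 3 ℕ.≤? m) m a³≤m (ℕ.≤-trans (m≤m^3 a) a³≤m)

⌊∛⌋-< : ∀ m → m ℕ.< suc ⌊∛ m ⌋ ℕ.^ 3
⌊∛⌋-< m = ℕ.≰⇒> λ h → ℕ.<-irrefl refl (⌊∛⌋-max m h)

frac : ℕ → ℕ → ℚ
frac a j = + a ℚ./ suc j

frac-≃ : ∀ a j → ℚ.toℚᵘ (frac a j) ℚᵘ.≃ ℚᵘ.mkℚᵘ (+ a) j
frac-≃ a j = ℚ.toℚᵘ-fromℚᵘ (ℚᵘ.mkℚᵘ (+ a) j)

frac-< : ∀ a i b j → a ℕ.* suc j ℕ.< b ℕ.* suc i → frac a i ℚ.< frac b j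
frac-< a i b j h = ℚ.toℚᵘ-cancel-<
  (ℚᵘ.<-respˡ-≃ (ℚᵘ.≃-sym (frac-≃ a i)) (ℚᵘ.<-respʳ-≃ (ℚᵘ.≃-sym (frac-≃ b j))
    (ℚᵘ.*<* (cast {a ℕ.* suc j} {b ℕ.* suc i} (ℤ.pos-* a (suc j)) (ℤ.pos-* b (suc i)) h))))
  where
  cast : ∀ {m n x y} → + m ≡ x → + n ≡ y → m ℕ.< n → x ℤ.< y
  cast refl refl m<n = ℤ.+<+ m<n

frac-≤ : ∀ a i b j → a ℕ.* suc j ℕ.≤ b ℕ.* suc i → frac a i ℚ.≤ frac b j
frac-≤ a i b j h = ℚ.toℚᵘ-cancel-≤
  (ℚᵘ.≤-respˡ-≃ (ℚᵘ.≃-sym (frac-≃ a i)) (ℚᵘ.≤-respʳ-≃ (ℚᵘ.≃-sym (frac-≃ b j))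
    (ℚᵘ.*≤* (cast {a ℕ.* suc j} {b ℕ.* suc i} (ℤ.pos-* a (suc j)) (ℤ.pos-* b (suc i)) h))))
  where
  cast : ∀ {m n x y} → + m ≡ x → + n ≡ y → m ℕ.≤ n → x ℤ.≤ y
  cast refl refl m≤n = ℤ.+≤+ m≤n

frac-suc : ∀ a j → frac (suc a) j ≡ frac a j ℚ.+ frac 1 j
frac-suc a j = ℚ.toℚᵘ-injective (begin
  ℚ.toℚᵘ (frac (suc a) j)                        ≈⟨ frac-≃ (suc a) j ⟩
  ℚᵘ.mkℚᵘ (+ suc a) j                            ≈⟨ ℚᵘ.*≡* cross ⟩
  ℚᵘ.mkℚᵘ (+ a) j ℚᵘ.+ ℚᵘ.mkℚᵘ (+ 1) j            ≈⟨ ℚᵘ.+-cong (frac-≃ a j) (frac-≃ 1 j) ⟨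
  ℚ.toℚᵘ (frac a j) ℚᵘ.+ ℚ.toℚᵘ (frac 1 j)       ≈⟨ ℚ.toℚᵘ-homo-+ (frac a j) (frac 1 j) ⟨
  ℚ.toℚᵘ (frac a j ℚ.+ frac 1 j)                 ∎)
  where
  open import Relation.Binary.Reasoning.Setoid ℚᵘ.≃-setoid
  d = + suc j
  cross : + suc a ℤ.* (d ℤ.* d) ≡ (+ a ℤ.* d ℤ.+ + 1 ℤ.* d) ℤ.* d
  cross = trans (sym (ℤ.*-assoc (+ suc a) d d)) (cong (ℤ._* d)
    (trans (cong (ℤ._* d) (cong +_ (ℕ.+-comm 1 a))) (ℤ.*-distribʳ-+ d (+ a) (+ 1))))

archimedean : ∀ ε → 0ℚ ℚ.< ε → ∃[ N ] (∀ n → N ℕ.≤ n → frac 1 n ℚ.< ε)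
archimedean ε@(ℚ.mkℚ (+ suc k) d _) _ = suc d , λ n d<n → ℚ.toℚᵘ-cancel-<
  (ℚᵘ.<-respˡ-≃ (ℚᵘ.≃-sym (frac-≃ 1 n)) (ℚᵘ.*<* (ℤ.+<+ (begin-strict
    suc d ℕ.+ 0          ≡⟨ ℕ.+-identityʳ (suc d) ⟩
    suc d                ≤⟨ d<n ⟩
    n                    <⟨ ℕ.n<1+n n ⟩
    suc n                ≤⟨ ℕ.m≤n*m (suc n) (suc k) ⟩
    suc k ℕ.* suc n      ∎))))
  where open ℕ.≤-Reasoning
archimedean (ℚ.mkℚ (+ 0) d _) (ℚ.*<* (ℤ.+<+ ()))
archimedean (ℚ.mkℚ (ℤ.-[1+ k ]) d _) (ℚ.*<* ())

cube-* : ∀ m n → (m ℕ.* n) ℕ.^ 3 ≡ m ℕ.^ 3 ℕ.* n ℕ.^ 3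
cube-* = solve 2 (λ m n → (m :* n) :^ 3 := m :^ 3 :* n :^ 3) refl
  where open ℕ-Solver

-- The term of index j is the largest multiple of 1/(j+1) whose cube is
-- at most n².
infix 9 _^⅔

⅔-num : ℕ → ℕ → ℕ
⅔-num n j = ⌊∛ n ℕ.^ 2 ℕ.* suc j ℕ.^ 3 ⌋

⅔-step : ∀ n i j → frac (⅔-num n i) i ℚ.< frac (⅔-num n j) j ℚ.+ frac 1 j
⅔-step n i j = subst (frac (⅔-num n i) i ℚ.<_) (frac-suc (⅔-num n j) j)
  (frac-< a i (suc b) j (ℕ.≰⇒> λ h → ℕ.<-irrefl refl (begin-strict
    (a ℕ.* suc j) ℕ.^ 3                           ≡⟨ cube-* a (suc j) ⟩
    a ℕ.^ 3 ℕ.* suc j ℕ.^ 3                       ≤⟨ ℕ.*-monoˡ-≤ (suc j ℕ.^ 3) (⌊∛⌋-≤ (n ℕ.^ 2 ℕ.* suc i ℕ.^ 3)) ⟩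
    n ℕ.^ 2 ℕ.* suc i ℕ.^ 3 ℕ.* suc j ℕ.^ 3       ≡⟨ swap (n ℕ.^ 2) (suc i ℕ.^ 3) (suc j ℕ.^ 3) ⟩
    n ℕ.^ 2 ℕ.* suc j ℕ.^ 3 ℕ.* suc i ℕ.^ 3       <⟨ ℕ.*-monoˡ-< (suc i ℕ.^ 3) {{ℕ.m^n≢0 (suc i) 3}}
                                                       (⌊∛⌋-< (n ℕ.^ 2 ℕ.* suc j ℕ.^ 3)) ⟩
    suc b ℕ.^ 3 ℕ.* suc i ℕ.^ 3                   ≡⟨ cube-* (suc b) (suc i) ⟨
    (suc b ℕ.* suc i) ℕ.^ 3                       ≤⟨ ℕ.^-monoˡ-≤ 3 h ⟩
    (a ℕ.* suc j) ℕ.^ 3                           ∎)))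
  where
  open ℕ.≤-Reasoning
  a = ⅔-num n i
  b = ⅔-num n j
  swap : ∀ x y z → x ℕ.* y ℕ.* z ≡ x ℕ.* z ℕ.* y
  swap x y z = trans (ℕ.*-assoc x y z) (trans (cong (x ℕ.*_) (ℕ.*-comm y z)) (sym (ℕ.*-assoc x z y)))

_^⅔ : ℕ → ℝ
n ^⅔ = mkℝ s c
  where
  s : ℕ → ℚ
  s j = frac (⅔-num n j) j
  c : IsCauchy s
  c ε 0<ε with archimedean ε 0<ε
  ... | N , h = N , λ i j N≤i N≤j → close {s i} {s j}
    (ℚ.<-trans (⅔-step n i j) (ℚ.+-monoʳ-< (s j) (h j N≤j)))
    (ℚ.<-trans (⅔-step n j i) (ℚ.+-monoʳ-< (s i) (h i N≤i)))

1≤⅔ : ∀ n → 1 ℕ.≤ n → ∀ j → 1ℚ ℚ.≤ seq (n ^⅔) j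
1≤⅔ n 1≤n j = frac-≤ 1 0 (⅔-num n j) j
  (subst (suc j ℕ.+ 0 ℕ.≤_) (sym (ℕ.*-identityʳ (⅔-num n j)))
    (subst (ℕ._≤ ⅔-num n j) (sym (ℕ.+-identityʳ (suc j)))
      (⌊∛⌋-max (n ℕ.^ 2 ℕ.* suc j ℕ.^ 3)
        (ℕ.m≤n*m (suc j ℕ.^ 3) (n ℕ.^ 2) {{ℕ.m^n≢0 n 2 {{ℕ.>-nonZero 1≤n}}}}))))

denominator : ℕ → ℝ
denominator n = fromℚ (+ 8 ℚ./ 1) * n ^⅔ - fromℚ (+ 4 ℚ./ 1)

denominator>0 : ∀ n → 1 ℕ.≤ n → 0ℝ < denominator n
denominator>0 n 1≤n = + 4 ℚ./ 1 , ℚ.positive⁻¹ (+ 4 ℚ./ 1) , 0 , λ j _ →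
  ℚ.+-monoˡ-≤ (ℚ.- (+ 4 ℚ./ 1)) (ℚ.*-monoˡ-≤-nonNeg (+ 8 ℚ./ 1) (1≤⅔ n 1≤n j))

bound : (n : ℕ) → 1 ℕ.≤ n → ℝ
bound n 1≤n = fromℚ (+ 1 ℚ./ 4) + recip (denominator n) (denominator>0 n 1≤n)

-- For 1 ≤ i ≤ ⌊√(k/2)⌋ one has i ≤ 2i² ≤ k, so the truncated
-- subtractions agree with the integer ones.
n*-term : ℕ → ℕ → ℕ
n*-term k i = 2 ℕ.* ((2 ℕ.* k ℕ.∸ 2 ℕ.* i ℕ.^ 2 ℕ.∸ i) ℕ./ 2) ℕ.+ i

n* : ℕ → ℕ
n* k = 2 ℕ.* k ℕ.+ 2 ℕ.* sum (applyUpTo (λ j → n*-term k (suc j)) ⌊√ k /2⌋)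

n*-pos : ∀ {k} → 7 ℕ.≤ k → 1 ℕ.≤ n* k
n*-pos {k} 7≤k = begin
  1                  ≤⟨ s≤s z≤n ⟩
  7                  ≤⟨ 7≤k ⟩
  k                  ≤⟨ ℕ.m≤m+n k (k ℕ.+ 0) ⟩
  2 ℕ.* k            ≤⟨ ℕ.m≤m+n (2 ℕ.* k) _ ⟩
  n* k               ∎
  where open ℕ.≤-Reasoning

-- A digraph with vertex set Fin order and arc set { (u , v) | T (arc u v) };
-- T b has at most one element, so there are no parallel arcs.
record WeightedDigraph : Set where
  field
    order    : ℕ
    arc      : Fin order → Fin order → Bool
    loopless : ∀ v → ¬ T (arc v v)
    weight   : ∀ u v → T (arc u v) → ℝ
    weight≥0 : ∀ u v (a : T (arc u v)) → 0ℝ ≤ weight u v a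

∑ : ∀ {n} → (Fin n → ℝ) → ℝ
∑ = Vector.foldr _+_ 0ℝ

maxSubset : ∀ n → (Subset n → ℝ) → ℝ
maxSubset zero    f = f []
maxSubset (suc n) f = maxSubset n (λ X → f (inside ∷ X)) ⊔ maxSubset n (λ X → f (outside ∷ X))

extendByZero : (b : Bool) → (T b → ℝ) → ℝ
extendByZero true  w = w tt
extendByZero false w = 0ℝ

module _ (D : WeightedDigraph) where
  open WeightedDigraph D

  Arc : Fin order → Fin order → Set
  Arc u v = T (arc u v)

  DirectedPath : List (Fin order) → Set
  DirectedPath vs = Linked Arc vs × Unique vs

  -- The closed walk v, vs, v whose vertices v, vs are distinct.
  DirectedCycle : Fin order → List (Fin order) → Set
  DirectedCycle v vs = Linked Arc (v ∷ vs ∷ʳ v) × Unique (v ∷ vs)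

  Acyclic : Set
  Acyclic = ∀ v vs → ¬ DirectedCycle v vs

  LongestPathOrder : ℕ → Set
  LongestPathOrder ν =
    (∃[ vs ] DirectedPath vs × length vs ≡ ν) ×
    (∀ vs → DirectedPath vs → length vs ℕ.≤ ν)

  arcWeight : Fin order → Fin order → ℝ
  arcWeight u v = extendByZero (arc u v) (weight u v)

  totalWeight : ℝ
  totalWeight = ∑ λ u → ∑ λ v → arcWeight u v

  weightBetween : Subset order → Subset order → ℝ
  weightBetween X Y = ∑ λ u → ∑ λ v →
    if lookup X u ∧ lookup Y v then arcWeight u v else 0ℝ

  -- X or its complement may be empty; such a cut has weight 0, so this
  -- does not affect the maximum when order ≥ 2.
  mac : ℝ
  mac = maxSubset order λ X → weightBetween X (∁ X)

IsSupremum : (ℝ → Set) → ℝ → Set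
IsSupremum S s = (∀ x → S x → x ≤ s) × (∀ u → (∀ x → S x → x ≤ u) → s ≤ u)

Admissible : ℕ → ℝ → Set
Admissible ν c = 0ℝ ≤ c ×
  (∀ D → Acyclic D → LongestPathOrder D ν → c * totalWeight D ≤ mac D)

-- c is the number c_ν; such a c is unique up to _≃_.
IsC : ℕ → ℝ → Set
IsC ν = IsSupremum (Admissible ν)

module Submission where

-- Let p = k / (4k − 2) = 1/4 + 1 / (8k − 4).  The height of a vertex (the
-- length of a longest walk leaving it) maps D to n = n* k levels so that arcs
-- go down.  It therefore suffices to find a random set of levels which, for
-- all i < j, contains i and misses j with probability at least p: the average
-- weight of the corresponding cuts of D is then at least p w(D).
--
-- Cut the levels into consecutive blocks L_m, …, L_1, L_0, R_1, …, R_m, where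
-- m = ⌊√(k/2)⌋ and L_i, R_i have s_i = n*-term k i elements.  Independently,
-- pick a uniformly random subset of (s_i + i)/2 levels of each L_i, and of
-- (s_i − i)/2 levels of each R_i.  Inside a block sampling without replacement
-- separates two levels with probability (s_i² − i²) / (4 s_i (s_i − 1)) ≥ p
-- because 2i² ≤ k; across blocks independence suffices because the densities
-- decrease from block to block.  Finally k³ ≤ n², so p is at least
-- 1/4 + 1 / (8 n^(2/3) − 4).

open import Algebra.Bundles using (Ring)
open import Data.Bool.Base using (Bool; true; false; T; not; _∧_; if_then_else_)
open import Data.Bool.Properties using (T?; ∧-comm; ∧-zeroʳ; ∧-identityʳ; not-involutive)
open import Data.Empty using (⊥-elim)
open import Data.Fin.Base as Fin using (Fin; zero; suc; toℕ; fromℕ<; splitAt; _↑ˡ_; _↑ʳ_)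
import Data.Fin.Properties as Fin
open import Data.Fin.Subset using (Subset; inside; outside; ∁)
import Data.Integer.Base as ℤ
import Data.Integer.Properties as ℤ
open import Data.List.Base
  using (List; []; _∷_; _∷ʳ_; _++_; map; length; concat; replicate; applyUpTo; cartesianProductWith)
open import Data.List.Membership.Propositional.Properties using (∈-∃++)
import Data.List.Properties as List
open import Data.List.Relation.Unary.All as All using (All; []; _∷_)
import Data.List.Relation.Unary.All.Properties as All
open import Data.List.Relation.Unary.AllPairs using (AllPairs; []; _∷_)
import Data.List.Relation.Unary.AllPairs.Properties as AllPairs
open import Data.List.Relation.Unary.Any as Any using (Any; here; there)
open import Data.List.Relation.Unary.Linked as Linked using (Linked; []; [-]; _∷_)
open import Data.List.Relation.Unary.Unique.Propositional using (Unique)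
open import Data.Nat.Base as ℕ using (ℕ; zero; suc; pred; z≤n; s≤s; _!)
import Data.Nat.DivMod as ℕ
open import Data.Nat.ListAction using (sum)
open import Data.Nat.ListAction.Properties using (sum-++)
import Data.Nat.Properties as ℕ
open import Data.Nat.Tactic.RingSolver using (solve-∀)
open import Data.Product.Base using (∃-syntax; _×_; _,_; proj₂)
open import Data.Rational.Base as ℚ using (ℚ; 0ℚ; 1ℚ; ½)
import Data.Rational.Properties as ℚ
open import Data.Rational.Solver using (module +-*-Solver)
import Data.Rational.Unnormalised.Base as ℚᵘ
import Data.Rational.Unnormalised.Properties as ℚᵘ
open import Data.Sum.Base using (inj₁; inj₂)
open import Data.Unit.Base using (⊤; tt)
open import Data.Vec.Base as Vec using (Vec; []; _∷_; lookup; tabulate)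
import Data.Vec.Properties as Vec
open import Function.Base using (_∘_; const)
open import Relation.Binary.PropositionalEquality
open import Relation.Nullary.Decidable using (Dec; yes; no; _×-dec_)
open import Algebra.Properties.CommutativeMonoid.Sum ℚ.+-0-commutativeMonoid as Sum using (∑-distrib-+; sum-cong-≗)
open import Algebra.Properties.Semiring.Sum (Ring.semiring ℚ.+-*-ring) using (*-distribˡ-sum)

private variable
  A B C : Set

-- Random sets of levels

module Levels where

  open import Data.Nat.Base using (_+_; _*_; _≤_; _∸_; _/_; _%_; _^_)
  open import Defs using (greatest; greatest-holds; greatest-max; ⌊√_/2⌋; n*; n*-term)

  -- Integration against counting measures.

  𝟙 : Bool → ℕ
  𝟙 true  = 1
  𝟙 false = 0

  𝟙-∧ : ∀ x y → 𝟙 (x ∧ y) ≡ 𝟙 x * 𝟙 y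
  𝟙-∧ true  y = sym (ℕ.*-identityˡ (𝟙 y))
  𝟙-∧ false y = refl

  -- A list stands for its counting measure.
  ∫ : List A → (A → ℕ) → ℕ
  ∫ xs f = sum (map f xs)

  ∫-cong : {f g : A → ℕ} → (∀ x → f x ≡ g x) → ∀ xs → ∫ xs f ≡ ∫ xs g
  ∫-cong f≗g xs = cong sum (List.map-cong f≗g xs)

  ∫-++ : ∀ xs ys (f : A → ℕ) → ∫ (xs ++ ys) f ≡ ∫ xs f + ∫ ys f
  ∫-++ xs ys f = trans (cong sum (List.map-++ f xs ys)) (sum-++ (map f xs) (map f ys))

  ∫-map : (g : A → B) (f : B → ℕ) → ∀ xs → ∫ (map g xs) f ≡ ∫ xs (f ∘ g)
  ∫-map g f xs = cong sum (sym (List.map-∘ xs))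

  ∫-zero : (xs : List A) → ∫ xs (const 0) ≡ 0
  ∫-zero []       = refl
  ∫-zero (x ∷ xs) = ∫-zero xs

  ∫-+ : (f g : A → ℕ) → ∀ xs → ∫ xs (λ x → f x + g x) ≡ ∫ xs f + ∫ xs g
  ∫-+ f g []       = refl
  ∫-+ f g (x ∷ xs) = trans (cong (f x + g x +_) (∫-+ f g xs)) (lemma (f x) (g x) (∫ xs f) (∫ xs g))
    where
    lemma : ∀ a b c d → a + b + (c + d) ≡ a + c + (b + d)
    lemma = solve-∀

  ∫-*ˡ : ∀ c (f : A → ℕ) xs → ∫ xs (λ x → c * f x) ≡ c * ∫ xs f
  ∫-*ˡ c f []       = sym (ℕ.*-zeroʳ c)
  ∫-*ˡ c f (x ∷ xs) = trans (cong (c * f x +_) (∫-*ˡ c f xs)) (sym (ℕ.*-distribˡ-+ c (f x) (∫ xs f)))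

  copies : ℕ → List A → List A
  copies n xs = concat (replicate n xs)

  ∫-copies : ∀ n xs (f : A → ℕ) → ∫ (copies n xs) f ≡ n * ∫ xs f
  ∫-copies zero    xs f = refl
  ∫-copies (suc n) xs f = trans (∫-++ xs (copies n xs) f) (cong (∫ xs f +_) (∫-copies n xs f))

  -- Fubini for product functions. This is the form in which the independence of different blocks is
  -- used.
  ∫-cartesian : (_•_ : A → B → C) (h : C → ℕ) (f : A → ℕ) (g : B → ℕ) →
    (∀ x y → h (x • y) ≡ f x * g y) →
    ∀ xs ys → ∫ (cartesianProductWith _•_ xs ys) h ≡ ∫ xs f * ∫ ys g
  ∫-cartesian _•_ h f g h≗ []       ys = refl
  ∫-cartesian _•_ h f g h≗ (x ∷ xs) ys = begin
    ∫ (map (x •_) ys ++ rest) h                ≡⟨ ∫-++ (map (x •_) ys) rest h ⟩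
    ∫ (map (x •_) ys) h + ∫ rest h             ≡⟨ cong₂ _+_ (∫-map (x •_) h ys) (∫-cartesian _•_ h f g h≗ xs ys) ⟩
    ∫ ys (h ∘ (x •_)) + ∫ xs f * ∫ ys g        ≡⟨ cong (_+ ∫ xs f * ∫ ys g) (∫-cong (h≗ x) ys) ⟩
    ∫ ys (λ y → f x * g y) + ∫ xs f * ∫ ys g   ≡⟨ cong (_+ ∫ xs f * ∫ ys g) (∫-*ˡ (f x) g ys) ⟩
    f x * ∫ ys g + ∫ xs f * ∫ ys g             ≡⟨ ℕ.*-distribʳ-+ (∫ ys g) (f x) (∫ xs f) ⟨
    (f x + ∫ xs f) * ∫ ys g                    ∎
    where
    open ≡-Reasoning
    rest = cartesianProductWith _•_ xs ys

  -- Sampling without replacement inside one block.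

  -- The arrangements of a trues and b falses, where s = a + b; the
  -- multiplicities make the total mass s ! instead of a binomial coefficient.
  shuffles : ∀ s → ℕ → ℕ → List (Vec Bool s)
  shuffles zero    a b = [] ∷ []
  shuffles (suc s) a b = copies a (map (true ∷_) (shuffles s (pred a) b)) ++
                         copies b (map (false ∷_) (shuffles s a (pred b)))

  -- Conditioning on the first entry, drawn from an urn with a trues and b falses. The evaluations
  -- below are inductions along this recursion.
  ∫-shuffles : ∀ s a b (f : Vec Bool (suc s) → ℕ) →
    ∫ (shuffles (suc s) a b) f ≡
    a * ∫ (shuffles s (pred a) b) (f ∘ (true ∷_)) + b * ∫ (shuffles s a (pred b)) (f ∘ (false ∷_))
  ∫-shuffles s a b f = trans (∫-++ (copies a xs) (copies b ys) f)
    (cong₂ _+_ (trans (∫-copies a xs f) (cong (a *_) (∫-map (true ∷_) f (shuffles s (pred a) b))))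
               (trans (∫-copies b ys f) (cong (b *_) (∫-map (false ∷_) f (shuffles s a (pred b))))))
    where
    xs = map (true ∷_) (shuffles s (pred a) b)
    ys = map (false ∷_) (shuffles s a (pred b))

  -- In the recursion a branch containing `pred a` carries the factor `a`. The induction hypothesis
  -- needs `pred a + b ≡ s`, which is available for positive `a`; for `a = 0` the branch vanishes.
  *-cong-≢0 : ∀ a {x y} → (∀ a′ → a ≡ suc a′ → x ≡ y) → a * x ≡ a * y
  *-cong-≢0 zero    x≡y = refl
  *-cong-≢0 (suc a) x≡y = cong (suc a *_) (x≡y a refl)

  pred-+ˡ : ∀ {a b s} → a + b ≡ suc s → ∀ a′ → a ≡ suc a′ → pred a + b ≡ s
  pred-+ˡ a+b≡1+s a′ refl = ℕ.suc-injective a+b≡1+s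

  pred-+ʳ : ∀ {a b s} → a + b ≡ suc s → ∀ b′ → b ≡ suc b′ → a + pred b ≡ s
  pred-+ʳ {a} a+b≡1+s b′ refl = ℕ.suc-injective (trans (sym (ℕ.+-suc a b′)) a+b≡1+s)

  *-pred : ∀ {a b s} → a + b ≡ suc s → a * pred a + b * a ≡ a * s
  *-pred {zero}  {b} _  = ℕ.*-zeroʳ b
  *-pred {suc a} {b} eq = trans (lemma a b) (cong (suc a *_) (ℕ.suc-injective eq))
    where
    lemma : ∀ a b → suc a * a + b * suc a ≡ suc a * (a + b)
    lemma = solve-∀

  shuffles-mass : ∀ s a b → a + b ≡ s → ∫ (shuffles s a b) (const 1) ≡ s !
  shuffles-mass zero    a b eq = refl
  shuffles-mass (suc s) a b eq = begin
    ∫ (shuffles (suc s) a b) (const 1)     ≡⟨ ∫-shuffles s a b (const 1) ⟩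
    a * ∫ (shuffles s (pred a) b) (const 1) + b * ∫ (shuffles s a (pred b)) (const 1)
      ≡⟨ cong₂ _+_ (*-cong-≢0 a λ a′ a≡ → shuffles-mass s (pred a) b (pred-+ˡ eq a′ a≡))
                   (*-cong-≢0 b λ b′ b≡ → shuffles-mass s a (pred b) (pred-+ʳ eq b′ b≡)) ⟩
    a * s ! + b * s !                      ≡⟨ ℕ.*-distribʳ-+ (s !) a b ⟨
    (a + b) * s !                          ≡⟨ cong (_* s !) eq ⟩
    suc s * s !                            ∎
    where open ≡-Reasoning

  -- By exchangeability all positions have density a / (s + 1), here multiplied by the total mass (s
  -- + 1)!. For a later position, `*-pred` merges the two branches of the recursion.
  shuffles-true : ∀ s a b → a + b ≡ suc s → ∀ i →
    ∫ (shuffles (suc s) a b) (λ x → 𝟙 (lookup x i)) ≡ a * s !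
  shuffles-true s a b eq zero = begin
    ∫ (shuffles (suc s) a b) (λ x → 𝟙 (lookup x zero))   ≡⟨ ∫-shuffles s a b _ ⟩
    a * ∫ (shuffles s (pred a) b) (const 1) + b * ∫ (shuffles s a (pred b)) (const 0)
      ≡⟨ cong₂ _+_ (*-cong-≢0 a λ a′ a≡ → shuffles-mass s (pred a) b (pred-+ˡ eq a′ a≡))
                   (cong (b *_) (∫-zero (shuffles s a (pred b)))) ⟩
    a * s ! + b * 0       ≡⟨ cong (a * s ! +_) (ℕ.*-zeroʳ b) ⟩
    a * s ! + 0           ≡⟨ ℕ.+-identityʳ _ ⟩
    a * s !               ∎
    where open ≡-Reasoning
  shuffles-true (suc s) a b eq (suc i) = begin
    ∫ (shuffles (suc (suc s)) a b) (λ x → 𝟙 (lookup x (suc i)))   ≡⟨ ∫-shuffles (suc s) a b _ ⟩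
    a * ∫ (shuffles (suc s) (pred a) b) (λ x → 𝟙 (lookup x i)) +
    b * ∫ (shuffles (suc s) a (pred b)) (λ x → 𝟙 (lookup x i))
      ≡⟨ cong₂ _+_ (*-cong-≢0 a λ a′ a≡ → shuffles-true s (pred a) b (pred-+ˡ eq a′ a≡) i)
                   (*-cong-≢0 b λ b′ b≡ → shuffles-true s a (pred b) (pred-+ʳ eq b′ b≡) i) ⟩
    a * (pred a * s !) + b * (a * s !)   ≡⟨ lemma a (pred a) b (s !) ⟩
    (a * pred a + b * a) * s !           ≡⟨ cong (_* s !) (*-pred {a} {b} eq) ⟩
    a * suc s * s !                      ≡⟨ ℕ.*-assoc a (suc s) (s !) ⟩
    a * (suc s * s !)                    ∎
    where
    open ≡-Reasoning
    lemma : ∀ a p b f → a * (p * f) + b * (a * f) ≡ (a * p + b * a) * f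
    lemma = solve-∀

  𝟙-not : ∀ x → 𝟙 x + 𝟙 (not x) ≡ 1
  𝟙-not true  = refl
  𝟙-not false = refl

  shuffles-false : ∀ s a b → a + b ≡ suc s → ∀ i →
    ∫ (shuffles (suc s) a b) (λ x → 𝟙 (not (lookup x i))) ≡ b * s !
  shuffles-false s a b eq i = ℕ.+-cancelˡ-≡ (a * s !) _ _ (begin
    a * s ! + ∫ xs (λ x → 𝟙 (not (lookup x i)))
      ≡⟨ cong (_+ ∫ xs (λ x → 𝟙 (not (lookup x i)))) (shuffles-true s a b eq i) ⟨
    ∫ xs (λ x → 𝟙 (lookup x i)) + ∫ xs (λ x → 𝟙 (not (lookup x i)))
      ≡⟨ ∫-+ _ _ xs ⟨
    ∫ xs (λ x → 𝟙 (lookup x i) + 𝟙 (not (lookup x i)))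
      ≡⟨ ∫-cong (λ x → 𝟙-not (lookup x i)) xs ⟩
    ∫ xs (const 1)         ≡⟨ shuffles-mass (suc s) a b eq ⟩
    suc s * s !            ≡⟨ cong (_* s !) eq ⟨
    (a + b) * s !          ≡⟨ ℕ.*-distribʳ-+ (s !) a b ⟩
    a * s ! + b * s !      ∎)
    where
    open ≡-Reasoning
    xs = shuffles (suc s) a b

  separates : ∀ {n} → Fin n → Fin n → Vec Bool n → ℕ
  separates i j x = 𝟙 (lookup x i ∧ not (lookup x j))

  -- The probability is ab / ((s + 2)(s + 1)), multiplied by the mass (s + 2)!. If one of the
  -- positions is the first, what remains is the density of the other; if neither is, both branches
  -- use the induction hypothesis.
  shuffles-separates : ∀ s a b → a + b ≡ suc (suc s) → ∀ i j → i ≢ j →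
    ∫ (shuffles (suc (suc s)) a b) (separates i j) ≡ a * b * s !
  shuffles-separates s a b eq zero zero i≢j = ⊥-elim (i≢j refl)
  shuffles-separates s a b eq zero (suc j) _ = begin
    ∫ (shuffles (suc (suc s)) a b) (separates zero (suc j))   ≡⟨ ∫-shuffles (suc s) a b _ ⟩
    a * ∫ (shuffles (suc s) (pred a) b) (λ x → 𝟙 (not (lookup x j))) +
    b * ∫ (shuffles (suc s) a (pred b)) (const 0)
      ≡⟨ cong₂ _+_ (*-cong-≢0 a λ a′ a≡ → shuffles-false s (pred a) b (pred-+ˡ eq a′ a≡) j)
                   (cong (b *_) (∫-zero (shuffles (suc s) a (pred b)))) ⟩
    a * (b * s !) + b * 0     ≡⟨ lemma a b (s !) ⟩
    a * b * s !               ∎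
    where
    open ≡-Reasoning
    lemma : ∀ a b f → a * (b * f) + b * 0 ≡ a * b * f
    lemma = solve-∀
  shuffles-separates s a b eq (suc i) zero _ = begin
    ∫ (shuffles (suc (suc s)) a b) (separates (suc i) zero)   ≡⟨ ∫-shuffles (suc s) a b _ ⟩
    a * ∫ (shuffles (suc s) (pred a) b) (λ x → 𝟙 (lookup x i ∧ false)) +
    b * ∫ (shuffles (suc s) a (pred b)) (λ x → 𝟙 (lookup x i ∧ true))
      ≡⟨ cong₂ _+_
           (cong (a *_) (trans (∫-cong (λ x → cong 𝟙 (∧-zeroʳ (lookup x i))) xs) (∫-zero xs)))
           (*-cong-≢0 b λ b′ b≡ → trans (∫-cong (λ x → cong 𝟙 (∧-identityʳ (lookup x i))) ys)
              (shuffles-true s a (pred b) (pred-+ʳ eq b′ b≡) i)) ⟩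
    a * 0 + b * (a * s !)     ≡⟨ lemma a b (s !) ⟩
    a * b * s !               ∎
    where
    open ≡-Reasoning
    xs = shuffles (suc s) (pred a) b
    ys = shuffles (suc s) a (pred b)
    lemma : ∀ a b f → a * 0 + b * (a * f) ≡ a * b * f
    lemma = solve-∀
  shuffles-separates zero a b eq (suc zero) (suc zero) i≢j = ⊥-elim (i≢j refl)
  shuffles-separates (suc s) a b eq (suc i) (suc j) i≢j = begin
    ∫ (shuffles (suc (suc (suc s))) a b) (separates (suc i) (suc j))   ≡⟨ ∫-shuffles (suc (suc s)) a b _ ⟩
    a * ∫ (shuffles (suc (suc s)) (pred a) b) (separates i j) +
    b * ∫ (shuffles (suc (suc s)) a (pred b)) (separates i j)
      ≡⟨ cong₂ _+_
           (*-cong-≢0 a λ a′ a≡ → shuffles-separates s (pred a) b (pred-+ˡ eq a′ a≡) i j (i≢j ∘ cong suc))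
           (*-cong-≢0 b λ b′ b≡ → shuffles-separates s a (pred b) (pred-+ʳ eq b′ b≡) i j (i≢j ∘ cong suc)) ⟩
    a * (pred a * b * s !) + b * (a * pred b * s !)   ≡⟨ lemma a (pred a) b (pred b) (s !) ⟩
    (a * pred a * b + a * (b * pred b)) * s !         ≡⟨ cong (_* s !) weights ⟩
    a * b * suc s * s !                               ≡⟨ ℕ.*-assoc (a * b) (suc s) (s !) ⟩
    a * b * (suc s * s !)                             ∎
    where
    open ≡-Reasoning
    lemma : ∀ a p b q f → a * (p * b * f) + b * (a * q * f) ≡ (a * p * b + a * (b * q)) * f
    lemma = solve-∀
    lemma₁ : ∀ a p b q → a * p * b + a * (b * q) + a * b * b ≡ b * (a * p + b * a) + a * (b * q)
    lemma₁ = solve-∀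
    lemma₂ : ∀ a b s q → b * (a * suc (suc s)) + a * (b * q) ≡ a * (b * q + 1 * b) + a * b * suc s
    lemma₂ = solve-∀
    *-suc-pred : ∀ b → b * pred b + 1 * b ≡ b * b
    *-suc-pred zero    = refl
    *-suc-pred (suc b) = square b
      where
      square : ∀ b → suc b * b + 1 * suc b ≡ suc b * suc b
      square = solve-∀
    -- For positive a and b this says `pred a + pred b ≡ suc s`, multiplied by ab. Adding
    -- `a * b * b` to both sides lets `*-pred` apply without any subtraction.
    weights : a * pred a * b + a * (b * pred b) ≡ a * b * suc s
    weights = ℕ.+-cancelʳ-≡ (a * b * b) _ _ (begin
      a * pred a * b + a * (b * pred b) + a * b * b     ≡⟨ lemma₁ a (pred a) b (pred b) ⟩
      b * (a * pred a + b * a) + a * (b * pred b)       ≡⟨ cong (λ t → b * t + a * (b * pred b)) (*-pred {a} {b} eq) ⟩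
      b * (a * suc (suc s)) + a * (b * pred b)          ≡⟨ lemma₂ a b s (pred b) ⟩
      a * (b * pred b + 1 * b) + a * b * suc s          ≡⟨ cong (λ t → a * t + a * b * suc s) (*-suc-pred b) ⟩
      a * (b * b) + a * b * suc s                       ≡⟨ cong (_+ a * b * suc s) (ℕ.*-assoc a b b) ⟨
      a * b * b + a * b * suc s                         ≡⟨ ℕ.+-comm (a * b * b) _ ⟩
      a * b * suc s + a * b * b                         ∎)

  -- Independent sampling over a list of blocks.

  record Block : Set where
    constructor block
    field
      trues falses : ℕ
    size : ℕ
    size = trues + falses

  open Block

  width : List Block → ℕ
  width bs = sum (map size bs)

  samples : ∀ bs → List (Vec Bool (width bs))
  samples []       = [] ∷ []
  samples (β ∷ bs) = cartesianProductWith Vec._++_ (shuffles (size β) (trues β) (falses β)) (samples bs)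

  mass : List Block → ℕ
  mass bs = ∫ (samples bs) (const 1)

  mass-∷ : ∀ β bs → mass (β ∷ bs) ≡ size β ! * mass bs
  mass-∷ β bs = trans
    (∫-cartesian Vec._++_ (const 1) (const 1) (const 1) (λ _ _ → refl) (shuffles (size β) _ _) (samples bs))
    (cong (_* mass bs) (shuffles-mass (size β) _ _ refl))

  mass>0 : ∀ bs → 0 ℕ.< mass bs
  mass>0 []       = s≤s z≤n
  mass>0 (β ∷ bs) = subst (0 ℕ.<_) (sym (mass-∷ β bs))
    (ℕ.*-mono-< (ℕ.1≤n! (size β)) (mass>0 bs))

  -- The other blocks integrate to their mass, which leaves the density of falses in the block
  -- containing `j`. Naming that block through `Any` allows it to be matched later with an `All` of
  -- compatibilities; its positive size is recorded for a cancellation.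
  samples-false : ∀ bs j → Any (λ β → 0 ℕ.< size β ×
    ∫ (samples bs) (λ x → 𝟙 (not (lookup x j))) * size β ≡ falses β * mass bs) bs
  samples-false (β ∷ bs) j with splitAt (size β) j | Fin.join-splitAt (size β) (width bs) j
  ... | inj₂ j′ | refl with samples-false bs j′
  ...   | p = there (Any.map (λ {γ} → λ (0<γ , eq) → 0<γ , (begin
    ∫ (samples (β ∷ bs)) _ * size γ      ≡⟨ cong (_* size γ) (∫-cartesian Vec._++_ _ (const 1) g
                                              (λ x y → trans (cong (𝟙 ∘ not) (Vec.lookup-++ʳ x y j′)) (sym (ℕ.*-identityˡ (g y)))) S (samples bs)) ⟩
    ∫ S (const 1) * ∫ (samples bs) g * size γ      ≡⟨ ℕ.*-assoc (∫ S (const 1)) _ (size γ) ⟩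
    ∫ S (const 1) * (∫ (samples bs) g * size γ)    ≡⟨ cong₂ _*_ (shuffles-mass (size β) _ _ refl) eq ⟩
    size β ! * (falses γ * mass bs)                ≡⟨ lemma (size β !) (falses γ) (mass bs) ⟩
    falses γ * (size β ! * mass bs)                ≡⟨ cong (falses γ *_) (mass-∷ β bs) ⟨
    falses γ * mass (β ∷ bs)                       ∎)) p)
    where
    open ≡-Reasoning
    S = shuffles (size β) (trues β) (falses β)
    g : Vec Bool (width bs) → ℕ
    g y = 𝟙 (not (lookup y j′))
    lemma : ∀ a b c → a * (b * c) ≡ b * (a * c)
    lemma = solve-∀
  samples-false (β ∷ bs) j | inj₁ j′ | refl = here (positive (size β) j′ , (begin
    ∫ (samples (β ∷ bs)) _ * size β      ≡⟨ cong (_* size β) (∫-cartesian Vec._++_ _ g (const 1)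
                                              (λ x y → trans (cong (𝟙 ∘ not) (Vec.lookup-++ˡ x y j′)) (sym (ℕ.*-identityʳ (g x)))) S (samples bs)) ⟩
    ∫ S g * mass bs * size β             ≡⟨ swap (∫ S g) (mass bs) (size β) ⟩
    ∫ S g * size β * mass bs             ≡⟨ cong (_* mass bs) (first (size β) (trues β) (falses β) refl j′) ⟩
    falses β * size β ! * mass bs        ≡⟨ ℕ.*-assoc (falses β) (size β !) (mass bs) ⟩
    falses β * (size β ! * mass bs)      ≡⟨ cong (falses β *_) (mass-∷ β bs) ⟨
    falses β * mass (β ∷ bs)             ∎))
    where
    open ≡-Reasoning
    S = shuffles (size β) (trues β) (falses β)
    g : Vec Bool (size β) → ℕ
    g x = 𝟙 (not (lookup x j′))
    swap : ∀ a b c → a * b * c ≡ a * c * b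
    swap = solve-∀
    shift : ∀ a b c → a * b * c ≡ a * (c * b)
    shift = solve-∀
    positive : ∀ n → Fin n → 0 ℕ.< n
    positive (suc n) _ = s≤s z≤n
    first : ∀ s a b → a + b ≡ s → ∀ j → ∫ (shuffles s a b) (λ x → 𝟙 (not (lookup x j))) * s ≡ b * s !
    first (suc s) a b eq j = trans (cong (_* suc s) (shuffles-false s a b eq j)) (shift b (s !) (suc s))

  -- The image of β when positions are reversed and true and false exchanged.
  flip : Block → Block
  flip β = block (falses β) (trues β)

  module _ (p q : ℕ) where

    -- The density of trues in α times that of falses in β is at least p / q.
    Compatible : Block → Block → Set
    Compatible α β = p * (size α * size β) ≤ q * (trues α * falses β)

    -- By `shuffles-separates`, two distinct positions of β are separated with probability trues ·
    -- falses / (size · (size - 1)). The condition says that this is at least p / q.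
    Balanced : Block → Set
    Balanced β = p * (size β * pred (size β)) ≤ q * (trues β * falses β)

    -- `flip` exchanges `left k i` and `right k i`, so this reduces the conditions between a block
    -- and an outer right block to those between an outer left block and the mirror image.
    compatible-flip : ∀ α β → Compatible α β → Compatible (flip β) (flip α)
    compatible-flip α β = subst₂ _≤_
      (cong (p *_) (trans (ℕ.*-comm (size α) (size β)) (cong₂ _*_ (ℕ.+-comm (trues β) _) (ℕ.+-comm (trues α) _))))
      (cong (q *_) (ℕ.*-comm (trues α) (falses β)))

    shuffles-separation : ∀ s a b → a + b ≡ s → p * (s * pred s) ≤ q * (a * b) → ∀ i j → i ≢ j →
      p * s ! ≤ q * ∫ (shuffles s a b) (separates i j)
    shuffles-separation (suc zero) a b eq _ zero zero i≢j = ⊥-elim (i≢j refl)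
    shuffles-separation (suc (suc s)) a b eq balanced i j i≢j = begin
      p * (suc (suc s) * (suc s * s !))                ≡⟨ assoc p (suc (suc s)) (suc s) (s !) ⟩
      p * (suc (suc s) * suc s) * s !                  ≤⟨ ℕ.*-monoˡ-≤ (s !) balanced ⟩
      q * (a * b) * s !                                ≡⟨ ℕ.*-assoc q (a * b) (s !) ⟩
      q * (a * b * s !)                                ≡⟨ cong (q *_) (shuffles-separates s a b eq i j i≢j) ⟨
      q * ∫ (shuffles (suc (suc s)) a b) (separates i j)   ∎
      where
      open ℕ.≤-Reasoning
      assoc : ∀ p x y z → p * (x * (y * z)) ≡ p * (x * y) * z
      assoc = solve-∀

    -- With x / A = a / s the probability of containing i and y / B = b / s′ that of missing j, this
    -- is p / q ≤ (x / A)(y / B) cleared of denominators.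
    cross-separation : ∀ {a s b s′ A B x y} → 0 ℕ.< s → 0 ℕ.< s′ →
      x * s ≡ a * A → y * s′ ≡ b * B → p * (s * s′) ≤ q * (a * b) →
      p * (A * B) ≤ q * (x * y)
    cross-separation {a} {s} {b} {s′} {A} {B} {x} {y} 0<s 0<s′ xs≡ ys′≡ h =
      ℕ.*-cancelʳ-≤ _ _ (s * s′) {{ℕ.>-nonZero (ℕ.*-mono-< 0<s 0<s′)}} (begin
        p * (A * B) * (s * s′)        ≡⟨ ac p A B s s′ ⟩
        p * (s * s′) * (A * B)        ≤⟨ ℕ.*-monoˡ-≤ (A * B) h ⟩
        q * (a * b) * (A * B)         ≡⟨ ac′ q a b A B ⟩
        q * ((a * A) * (b * B))       ≡⟨ cong₂ (λ u v → q * (u * v)) xs≡ ys′≡ ⟨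
        q * ((x * s) * (y * s′))      ≡⟨ ac″ q x s y s′ ⟩
        q * (x * y) * (s * s′)        ∎)
      where
      open ℕ.≤-Reasoning
      ac : ∀ p A B s s′ → p * (A * B) * (s * s′) ≡ p * (s * s′) * (A * B)
      ac = solve-∀
      ac′ : ∀ q a b A B → q * (a * b) * (A * B) ≡ q * ((a * A) * (b * B))
      ac′ = solve-∀
      ac″ : ∀ q x s y s′ → q * ((x * s) * (y * s′)) ≡ q * (x * y) * (s * s′)
      ac″ = solve-∀

    -- Four cases, by whether i and j lie in the first block. Both inside: `Balanced`. Both beyond:
    -- the induction hypothesis. Only j inside: impossible as i < j. Only i inside: independence and
    -- `Compatible`.
    samples-separation : ∀ bs → All Balanced bs → AllPairs Compatible bs →
      ∀ i j → i Fin.< j → p * mass bs ≤ q * ∫ (samples bs) (separates i j)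
    samples-separation (β ∷ bs) (bal ∷ bals) (com ∷ coms) i j i<j
      with splitAt (size β) i | Fin.join-splitAt (size β) (width bs) i
         | splitAt (size β) j | Fin.join-splitAt (size β) (width bs) j
    ... | inj₁ i′ | refl | inj₁ j′ | refl = begin
      p * mass (β ∷ bs)                 ≡⟨ cong (p *_) (mass-∷ β bs) ⟩
      p * (size β ! * mass bs)          ≡⟨ ℕ.*-assoc p (size β !) (mass bs) ⟨
      p * size β ! * mass bs            ≤⟨ ℕ.*-monoˡ-≤ (mass bs) (shuffles-separation (size β) _ _ refl bal i′ j′
                                             λ { refl → ℕ.<-irrefl refl i<j }) ⟩
      q * ∫ S (separates i′ j′) * mass bs     ≡⟨ ℕ.*-assoc q (∫ S (separates i′ j′)) (mass bs) ⟩
      q * (∫ S (separates i′ j′) * mass bs)   ≡⟨ cong (q *_) (∫-cartesian Vec._++_ _ (separates i′ j′) (const 1)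
           (λ x y → trans (cong₂ (λ u v → 𝟙 (u ∧ not v)) (Vec.lookup-++ˡ x y i′) (Vec.lookup-++ˡ x y j′))
                          (sym (ℕ.*-identityʳ (separates i′ j′ x)))) S (samples bs)) ⟨
      q * ∫ (samples (β ∷ bs)) (separates (i′ ↑ˡ width bs) (j′ ↑ˡ width bs))   ∎
      where
      open ℕ.≤-Reasoning
      S = shuffles (size β) (trues β) (falses β)
    ... | inj₂ i′ | refl | inj₂ j′ | refl = begin
      p * mass (β ∷ bs)                 ≡⟨ cong (p *_) (mass-∷ β bs) ⟩
      p * (size β ! * mass bs)          ≡⟨ swap p (size β !) (mass bs) ⟩
      size β ! * (p * mass bs)          ≤⟨ ℕ.*-monoʳ-≤ (size β !) (samples-separation bs bals coms i′ j′
        (ℕ.+-cancelˡ-< (size β) _ _ (subst₂ ℕ._<_ (Fin.toℕ-↑ʳ (size β) i′) (Fin.toℕ-↑ʳ (size β) j′) i<j))) ⟩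
      size β ! * (q * ∫ (samples bs) (separates i′ j′))   ≡⟨ swap q (size β !) _ ⟨
      q * (size β ! * ∫ (samples bs) (separates i′ j′))   ≡⟨ cong (λ m → q * (m * _)) (shuffles-mass (size β) _ _ refl) ⟨
      q * (∫ S (const 1) * ∫ (samples bs) (separates i′ j′))   ≡⟨ cong (q *_) (∫-cartesian Vec._++_ _ (const 1) (separates i′ j′)
           (λ x y → trans (cong₂ (λ u v → 𝟙 (u ∧ not v)) (Vec.lookup-++ʳ x y i′) (Vec.lookup-++ʳ x y j′))
                          (sym (ℕ.*-identityˡ (separates i′ j′ y)))) S (samples bs)) ⟨
      q * ∫ (samples (β ∷ bs)) (separates (size β ↑ʳ i′) (size β ↑ʳ j′))   ∎
      where
      open ℕ.≤-Reasoning
      S = shuffles (size β) (trues β) (falses β)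
      swap : ∀ a b c → a * (b * c) ≡ b * (a * c)
      swap = solve-∀
    ... | inj₂ i′ | refl | inj₁ j′ | refl = ⊥-elim (ℕ.<-irrefl refl (begin-strict
      size β + toℕ i′                ≡⟨ Fin.toℕ-↑ʳ (size β) i′ ⟨
      toℕ (size β ↑ʳ i′)             <⟨ i<j ⟩
      toℕ (j′ ↑ˡ width bs)           ≡⟨ Fin.toℕ-↑ˡ j′ (width bs) ⟩
      toℕ j′                         <⟨ Fin.toℕ<n j′ ⟩
      size β                         ≤⟨ ℕ.m≤m+n (size β) (toℕ i′) ⟩
      size β + toℕ i′                ∎))
      where open ℕ.≤-Reasoning
    ... | inj₁ i′ | refl | inj₂ j′ | refl = begin
      p * mass (β ∷ bs)                 ≡⟨ cong (p *_) (mass-∷ β bs) ⟩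
      p * (size β ! * mass bs)          ≤⟨ bound ⟩
      q * (∫ S f * ∫ (samples bs) g)    ≡⟨ cong (q *_) (∫-cartesian Vec._++_ _ f g
           (λ x y → trans (cong₂ (λ u v → 𝟙 (u ∧ not v)) (Vec.lookup-++ˡ x y i′) (Vec.lookup-++ʳ x y j′))
                          (𝟙-∧ (lookup x i′) (not (lookup y j′)))) S (samples bs)) ⟨
      q * ∫ (samples (β ∷ bs)) (separates (i′ ↑ˡ width bs) (size β ↑ʳ j′))   ∎
      where
      open ℕ.≤-Reasoning
      S = shuffles (size β) (trues β) (falses β)
      f : Vec Bool (size β) → ℕ
      f x = 𝟙 (lookup x i′)
      g : Vec Bool (width bs) → ℕ
      g y = 𝟙 (not (lookup y j′))
      first : ∀ s a b → a + b ≡ s → ∀ i → 0 ℕ.< s × ∫ (shuffles s a b) (λ x → 𝟙 (lookup x i)) * s ≡ a * s !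
      first (suc s) a b eq i = s≤s z≤n , trans (cong (_* suc s) (shuffles-true s a b eq i)) (shift a (s !) (suc s))
        where
        shift : ∀ a b c → a * b * c ≡ a * (c * b)
        shift = solve-∀
      bound : p * (size β ! * mass bs) ≤ q * (∫ S f * ∫ (samples bs) g)
      -- `lookupAny` selects the compatibility of β with the very block that contains `j′`.
      bound with All.lookupAny com (samples-false bs j′) | first (size β) (trues β) (falses β) refl i′
      ... | compat , 0<γ , out | 0<β , in′ =
        cross-separation {a = trues β} {A = size β !} {x = ∫ S f} {y = ∫ (samples bs) g} 0<β 0<γ in′ out compat

  -- Polynomial inequalities behind the probability k / (2K), where K = 2k - 1.

  halve-≤ : ∀ {x y} → 2 * x ≤ 2 * y → x ≤ y
  halve-≤ = ℕ.*-cancelˡ-≤ 2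

  module _ {k K : ℕ} (2k≡1+K : 2 * k ≡ suc K) where

    open ℕ.≤-Reasoning

    outer-size : ∀ {j s} → 0 ℕ.< j → s + 2 * (j * j) ≤ 2 * k → s ≤ K
    outer-size {j} {s} 0<j outer = ℕ.≤-pred (begin
      suc s                 ≡⟨ ℕ.+-comm 1 s ⟩
      s + 1                 ≤⟨ ℕ.+-monoʳ-≤ s (ℕ.≤-trans (ℕ.*-mono-≤ 0<j 0<j) (ℕ.m≤n*m (j * j) 2)) ⟩
      s + 2 * (j * j)       ≤⟨ outer ⟩
      2 * k                 ≡⟨ 2k≡1+K ⟩
      suc K                 ∎)

    -- The compatibility of L_j with L_i, where h and h′ stand for half k i and
    -- half k j and K = 2k − 1; outer-opposite is that of L_j with R_i.
    outer-inner : ∀ {i j h h′ r} → i ℕ.< j → r ≤ 1 →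
      h + i + h + 2 * (i * i) + r ≡ 2 * k → h′ + j + h′ + 2 * (j * j) ≤ 2 * k →
      k * ((h′ + j + h′) * (h + i + h)) ≤ 2 * K * ((h′ + j) * h)
    outer-inner {i} {j} {h} {h′} {r} i<j r≤1 inner outer = halve-≤ (begin
      2 * (k * (S * (h + i + h)))             ≡⟨ e₁ k S h i ⟩
      2 * k * (S * (H + i))                   ≡⟨ cong (_* (S * (H + i))) 2k≡1+K ⟩
      suc K * (S * (H + i))                   ≡⟨ e₂ K S H i ⟩
      K * (S * H) + (K * (S * i) + S * (H + i))   ≤⟨ ℕ.+-monoʳ-≤ (K * (S * H)) excess ⟩
      K * (S * H) + K * (j * H)               ≡⟨ e₃ K h′ j h ⟩
      2 * (2 * K * ((h′ + j) * h))            ∎)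
      where
      S = h′ + j + h′
      H = 2 * h
      e₁ : ∀ k S h i → 2 * (k * (S * (h + i + h))) ≡ 2 * k * (S * (2 * h + i))
      e₁ = solve-∀
      e₂ : ∀ K S H i → suc K * (S * (H + i)) ≡ K * (S * H) + (K * (S * i) + S * (H + i))
      e₂ = solve-∀
      e₃ : ∀ K h′ j h → K * ((h′ + j + h′) * (2 * h)) + K * (j * (2 * h)) ≡ 2 * (2 * K * ((h′ + j) * h))
      e₃ = solve-∀
      -- Blocks shrink quickly outwards: as j ≥ i + 1, the term 2j² exceeds 2i² by at least 4i + 2,
      -- while H loses only i and the rounding r ≤ 1. In fact H - S ≥ 3i + 1.
      1+S≤H : suc S ≤ H
      1+S≤H = ℕ.+-cancelʳ-≤ (i + 2 * (i * i) + 1) _ _ (begin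
        suc S + (i + 2 * (i * i) + 1)                    ≤⟨ ℕ.m≤m+n _ (3 * i) ⟩
        suc S + (i + 2 * (i * i) + 1) + 3 * i            ≡⟨ e₄ S i ⟩
        S + 2 * (suc i * suc i)                          ≤⟨ ℕ.+-monoʳ-≤ S (ℕ.*-monoʳ-≤ 2 (ℕ.*-mono-≤ i<j i<j)) ⟩
        S + 2 * (j * j)                                  ≤⟨ outer ⟩
        2 * k                                            ≡⟨ inner ⟨
        h + i + h + 2 * (i * i) + r                      ≤⟨ ℕ.+-monoʳ-≤ _ r≤1 ⟩
        h + i + h + 2 * (i * i) + 1                      ≡⟨ e₅ h i ⟩
        H + (i + 2 * (i * i) + 1)                        ∎)
        where
        e₄ : ∀ S i → suc S + (i + 2 * (i * i) + 1) + 3 * i ≡ S + 2 * (suc i * suc i)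
        e₄ = solve-∀
        e₅ : ∀ h i → h + i + h + 2 * (i * i) + 1 ≡ 2 * h + (i + 2 * (i * i) + 1)
        e₅ = solve-∀
      0<j : 0 ℕ.< j
      0<j = ℕ.≤-<-trans z≤n i<j
      S≤K : S ≤ K
      S≤K = outer-size {j} 0<j outer
      -- Since S ≤ K, it is enough that i(S + 1) + H ≤ jH, which follows from S + 1 ≤ H and i + 1 ≤
      -- j.
      excess : K * (S * i) + S * (H + i) ≤ K * (j * H)
      excess = begin
        K * (S * i) + S * (H + i)      ≤⟨ ℕ.+-monoʳ-≤ (K * (S * i)) (ℕ.*-monoˡ-≤ (H + i) S≤K) ⟩
        K * (S * i) + K * (H + i)      ≡⟨ e₆ K S H i ⟩
        K * (i * suc S + H)            ≤⟨ ℕ.*-monoʳ-≤ K (ℕ.+-monoˡ-≤ H (ℕ.*-monoʳ-≤ i 1+S≤H)) ⟩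
        K * (i * H + H)                ≡⟨ cong (K *_) (ℕ.+-comm (i * H) H) ⟩
        K * (suc i * H)                ≤⟨ ℕ.*-monoʳ-≤ K (ℕ.*-monoˡ-≤ H i<j) ⟩
        K * (j * H)                    ∎
        where
        e₆ : ∀ K S H i → K * (S * i) + K * (H + i) ≡ K * (i * suc S + H)
        e₆ = solve-∀

    outer-opposite : ∀ {i j h h′} → 0 ℕ.< j → h′ + j + h′ + 2 * (j * j) ≤ 2 * k →
      k * ((h′ + j + h′) * (h + (h + i))) ≤ 2 * K * ((h′ + j) * (h + i))
    outer-opposite {i} {j} {h} {h′} 0<j outer = halve-≤ (begin
      2 * (k * (S * (h + (h + i))))             ≡⟨ e₁ k S h i ⟩
      2 * k * S * (h + h + i)                   ≡⟨ cong (λ t → t * S * (h + h + i)) 2k≡1+K ⟩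
      -- In R_i at least half of the entries are false, which accounts for the second factor. For
      -- L_j it remains that (K + 1)S ≤ K(S + j), where S + j is twice the number of trues.
      suc K * S * (h + h + i)                   ≤⟨ ℕ.*-mono-≤ 1+K*S≤ (ℕ.m≤m+n _ i) ⟩
      K * (S + j) * (h + h + i + i)             ≡⟨ e₃ K h′ j h i ⟩
      2 * (2 * K * ((h′ + j) * (h + i)))        ∎)
      where
      S = h′ + j + h′
      e₁ : ∀ k S h i → 2 * (k * (S * (h + (h + i)))) ≡ 2 * k * S * (h + h + i)
      e₁ = solve-∀
      e₃ : ∀ K h′ j h i → K * (h′ + j + h′ + j) * (h + h + i + i) ≡ 2 * (2 * K * ((h′ + j) * (h + i)))
      e₃ = solve-∀
      S≤K : S ≤ K
      S≤K = outer-size {j} 0<j outer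
      1+K*S≤ : suc K * S ≤ K * (S + j)
      1+K*S≤ = begin
        S + K * S        ≤⟨ ℕ.+-monoˡ-≤ (K * S) S≤K ⟩
        K + K * S        ≤⟨ ℕ.+-monoˡ-≤ (K * S) (ℕ.m≤m*n K j {{ℕ.>-nonZero 0<j}}) ⟩
        K * j + K * S    ≡⟨ e₂ K S j ⟩
        K * (S + j)      ∎
        where
        e₂ : ∀ K S j → K * j + K * S ≡ K * (S + j)
        e₂ = solve-∀

    -- What `balanced` comes down to. If r = 0, then 2i² ≤ k gives s ≥ k, hence K ≤ 2s. If r = 1,
    -- then s ≥ k - 1 only, hence K ≤ 2s + 1; the additional i² is paid for by the additional s on
    -- the right.
    balanced-slack : ∀ {i s r} → r ≤ 1 → s + 2 * (i * i) + r ≡ 2 * k → 2 * (i * i) ≤ k →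
      K * (i * i) ≤ s * (2 * (i * i) + r)
    balanced-slack {i} {s} {0} _ eq 2i²≤k = begin
      K * (i * i)               ≤⟨ ℕ.*-monoˡ-≤ (i * i) (ℕ.n≤1+n K) ⟩
      suc K * (i * i)           ≡⟨ cong (_* (i * i)) 2k≡1+K ⟨
      2 * k * (i * i)           ≤⟨ ℕ.*-monoˡ-≤ (i * i) (ℕ.*-monoʳ-≤ 2 k≤s) ⟩
      2 * s * (i * i)           ≡⟨ e s (i * i) ⟩
      s * (2 * (i * i) + 0)     ∎
      where
      e : ∀ s x → 2 * s * x ≡ s * (2 * x + 0)
      e = solve-∀
      k≤s : k ≤ s
      k≤s = ℕ.+-cancelʳ-≤ k _ _ (begin
        k + k                     ≡⟨ cong (k +_) (ℕ.+-identityʳ k) ⟨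
        2 * k                     ≡⟨ eq ⟨
        s + 2 * (i * i) + 0       ≡⟨ ℕ.+-identityʳ _ ⟩
        s + 2 * (i * i)           ≤⟨ ℕ.+-monoʳ-≤ s 2i²≤k ⟩
        s + k                     ∎)
    balanced-slack {i} {s} {1} _ eq 2i²≤k = begin
      K * (i * i)                    ≤⟨ ℕ.*-monoˡ-≤ (i * i) (ℕ.≤-pred 1+K≤) ⟩
      suc (2 * s) * (i * i)          ≡⟨ e₂ s (i * i) ⟩
      2 * s * (i * i) + i * i        ≤⟨ ℕ.+-monoʳ-≤ (2 * s * (i * i)) i²≤s ⟩
      2 * s * (i * i) + s            ≡⟨ e₁ s (i * i) ⟩
      s * (2 * (i * i) + 1)          ∎
      where
      e₁ : ∀ s x → 2 * s * x + s ≡ s * (2 * x + 1)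
      e₁ = solve-∀
      e₂ : ∀ s x → suc (2 * s) * x ≡ 2 * s * x + x
      e₂ = solve-∀
      k≤1+s : k ≤ suc s
      k≤1+s = ℕ.+-cancelʳ-≤ k _ _ (begin
        k + k                     ≡⟨ cong (k +_) (ℕ.+-identityʳ k) ⟨
        2 * k                     ≡⟨ eq ⟨
        s + 2 * (i * i) + 1       ≡⟨ ℕ.+-comm _ 1 ⟩
        suc s + 2 * (i * i)       ≤⟨ ℕ.+-monoʳ-≤ (suc s) 2i²≤k ⟩
        suc s + k                 ∎)
      1+K≤ : suc K ≤ suc (suc (2 * s))
      1+K≤ = begin
        suc K              ≡⟨ 2k≡1+K ⟨
        2 * k              ≤⟨ ℕ.*-monoʳ-≤ 2 k≤1+s ⟩
        2 * suc s          ≡⟨ ℕ.*-suc 2 s ⟩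
        suc (suc (2 * s))  ∎
      double : ∀ x → 2 * x ≤ suc s → x ≤ s
      double zero    _ = z≤n
      double (suc x) h = ℕ.≤-pred (begin
        suc (suc x)        ≤⟨ ℕ.m≤m+n (suc (suc x)) x ⟩
        suc (suc x) + x    ≡⟨ e₃ x ⟩
        2 * suc x          ≤⟨ h ⟩
        suc s              ∎)
        where
        e₃ : ∀ x → suc (suc x) + x ≡ 2 * suc x
        e₃ = solve-∀
      i²≤s : i * i ≤ s
      i²≤s = double (i * i) (ℕ.≤-trans 2i²≤k k≤1+s)
    balanced-slack {r = suc (suc _)} (s≤s ()) _ _

    -- Twice the right side is K(s² - i²), because 4h(h + i) = s² - i². Twice the left side is Ks² -
    -- s(2i² + r), because 2k is both K + 1 and s + 2i² + r. Both are padded by Ki² + s² to stay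
    -- within the naturals.
    balanced : ∀ {i h s r} → s ≡ 2 * h + i → r ≤ 1 → s + 2 * (i * i) + r ≡ 2 * k → 2 * (i * i) ≤ k →
      k * (s * pred s) ≤ 2 * K * (h * (h + i))
    balanced {s = zero} _ _ _ _ = ℕ.≤-trans (ℕ.≤-reflexive (ℕ.*-zeroʳ k)) z≤n
    balanced {i} {h} {s@(suc s′)} {r} s≡ r≤1 eq 2i²≤k =
      halve-≤ (ℕ.+-cancelʳ-≤ (K * (i * i) + s * s) _ _ (begin
        2 * (k * (s * s′)) + (K * (i * i) + s * s)
          ≤⟨ ℕ.+-monoʳ-≤ (2 * (k * (s * s′))) (ℕ.+-monoˡ-≤ (s * s) (balanced-slack {i} {s} r≤1 eq 2i²≤k)) ⟩
        2 * (k * (s * s′)) + (s * (2 * (i * i) + r) + s * s)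
          ≡⟨ e₁ k s s′ (2 * (i * i)) r ⟩
        2 * k * (s * s′) + s * (s + 2 * (i * i) + r)
          ≡⟨ cong (λ t → 2 * k * (s * s′) + s * t) eq ⟩
        2 * k * (s * s′) + s * (2 * k)
          ≡⟨ e₂ (2 * k) s′ ⟩
        2 * k * (s * s)
          ≡⟨ cong (_* (s * s)) 2k≡1+K ⟩
        suc K * (s * s)
          ≡⟨ cong (λ t → s * s + K * (t * t)) s≡ ⟩
        s * s + K * ((2 * h + i) * (2 * h + i))
          ≡⟨ e₃ K h i (s * s) ⟩
        2 * (2 * K * (h * (h + i))) + (K * (i * i) + s * s) ∎))
      where
      e₁ : ∀ k s s′ x r → 2 * (k * (s * s′)) + (s * (x + r) + s * s) ≡ 2 * k * (s * s′) + s * (s + x + r)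
      e₁ = solve-∀
      e₂ : ∀ m s′ → m * (suc s′ * s′) + suc s′ * m ≡ m * (suc s′ * suc s′)
      e₂ = solve-∀
      e₃ : ∀ K h i x → x + K * ((2 * h + i) * (2 * h + i)) ≡ 2 * (2 * K * (h * (h + i))) + (K * (i * i) + x)
      e₃ = solve-∀

  -- The blocks L_i and R_i.

  half : ℕ → ℕ → ℕ
  half k i = (2 * k ∸ 2 * i ^ 2 ∸ i) / 2

  left right : ℕ → ℕ → Block
  left  k i = block (half k i + i) (half k i)
  right k i = block (half k i) (half k i + i)

  -- Built outwards from the centre L_0, which is `left k 0`, so that each induction step adds one
  -- outermost pair and compares it with everything inside.
  blocks : ℕ → ℕ → List Block
  blocks k zero    = left k 0 ∷ []
  blocks k (suc i) = left k (suc i) ∷ blocks k i ∷ʳ right k (suc i)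

  ^2-≡ : ∀ i → i ^ 2 ≡ i * i
  ^2-≡ i = cong (i *_) (ℕ.*-identityʳ i)

  n≤n² : ∀ n → n ≤ n * n
  n≤n² zero    = z≤n
  n≤n² (suc n) = ℕ.m≤m*n (suc n) (suc n)

  -- Here r is the remainder lost by the division by 2. As i ≤ 2i² ≤ k, no subtraction is truncated.
  n*-term-spec : ∀ {k i} → 2 * (i * i) ≤ k →
    ∃[ r ] (r ≤ 1 × n*-term k i + 2 * (i * i) + r ≡ 2 * k)
  n*-term-spec {k} {i} 2i²≤k = t % 2 , ℕ.≤-pred (ℕ.m%n<n t 2) , (begin
    2 * (t / 2) + i + 2 * (i * i) + t % 2      ≡⟨ e (t / 2) i (2 * (i * i)) (t % 2) ⟩
    t % 2 + t / 2 * 2 + i + 2 * (i * i)        ≡⟨ cong (λ x → x + i + 2 * (i * i)) (ℕ.m≡m%n+[m/n]*n t 2) ⟨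
    t + i + 2 * (i * i)                        ≡⟨ cong (λ x → 2 * k ∸ 2 * x ∸ i + i + 2 * (i * i)) (^2-≡ i) ⟩
    2 * k ∸ 2 * (i * i) ∸ i + i + 2 * (i * i)  ≡⟨ cong (_+ 2 * (i * i)) (ℕ.m∸n+n≡m i≤) ⟩
    2 * k ∸ 2 * (i * i) + 2 * (i * i)          ≡⟨ ℕ.m∸n+n≡m (ℕ.≤-trans 2i²≤k (ℕ.m≤m+n k _)) ⟩
    2 * k                                      ∎)
    where
    open ≡-Reasoning
    t = 2 * k ∸ 2 * i ^ 2 ∸ i
    e : ∀ q i x m → 2 * q + i + x + m ≡ m + q * 2 + i + x
    e = solve-∀
    i≤k : i ≤ k
    i≤k = ℕ.≤-trans (n≤n² i) (ℕ.≤-trans (ℕ.m≤n*m (i * i) 2) 2i²≤k)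
    i≤ : i ≤ 2 * k ∸ 2 * (i * i)
    i≤ = ℕ.m+n≤o⇒m≤o∸n i (ℕ.≤-trans (ℕ.+-mono-≤ i≤k 2i²≤k) (ℕ.≤-reflexive (cong (k +_) (sym (ℕ.+-identityʳ k)))))

  size-left : ∀ k i → size (left k i) ≡ n*-term k i
  size-left k i = e (half k i) i
    where
    e : ∀ h i → h + i + h ≡ 2 * h + i
    e = solve-∀

  size-right : ∀ k i → size (right k i) ≡ n*-term k i
  size-right k i = e (half k i) i
    where
    e : ∀ h i → h + (h + i) ≡ 2 * h + i
    e = solve-∀

  square-mono : ∀ {i j k} → i ≤ j → 2 * (j * j) ≤ k → 2 * (i * i) ≤ k
  square-mono i≤j = ℕ.≤-trans (ℕ.*-monoʳ-≤ 2 (ℕ.*-mono-≤ i≤j i≤j))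

  module _ {k K : ℕ} (2k≡1+K : 2 * k ≡ suc K) where

    private
      Comp = Compatible k (2 * K)
      Bal  = Balanced k (2 * K)

    size-left-spec : ∀ {i} → 2 * (i * i) ≤ k →
      ∃[ r ] (r ≤ 1 × size (left k i) + 2 * (i * i) + r ≡ 2 * k)
    size-left-spec {i} 2i²≤k =
      let r , r≤1 , eq = n*-term-spec {k} {i} 2i²≤k
      in r , r≤1 , trans (cong (λ s → s + 2 * (i * i) + r) (size-left k i)) eq

    size-left-≤ : ∀ {i} → 2 * (i * i) ≤ k → size (left k i) + 2 * (i * i) ≤ 2 * k
    size-left-≤ {i} 2i²≤k = let r , _ , eq = size-left-spec {i} 2i²≤k in
      subst (size (left k i) + 2 * (i * i) ≤_) eq (ℕ.m≤m+n _ r)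

    left-left : ∀ {i j} → i ℕ.< j → 2 * (i * i) ≤ k → 2 * (j * j) ≤ k → Comp (left k j) (left k i)
    left-left {i} {j} i<j 2i²≤k 2j²≤k = let r , r≤1 , eq = size-left-spec {i} 2i²≤k in
      outer-inner {k} {K} 2k≡1+K {i} {j} {half k i} {half k j} {r} i<j r≤1 eq (size-left-≤ {j} 2j²≤k)

    left-right : ∀ i {j} → 0 ℕ.< j → 2 * (j * j) ≤ k → Comp (left k j) (right k i)
    left-right i {j} 0<j 2j²≤k = outer-opposite {k} {K} 2k≡1+K {i} {j} {half k i} {half k j} 0<j (size-left-≤ {j} 2j²≤k)

    left-balanced : ∀ {i} → 2 * (i * i) ≤ k → Bal (left k i)
    left-balanced {i} 2i²≤k = let r , r≤1 , eq = size-left-spec {i} 2i²≤k in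
      subst (λ t → k * (size (left k i) * pred (size (left k i))) ≤ 2 * K * t) (ℕ.*-comm (half k i) (half k i + i))
        (balanced {k} {K} 2k≡1+K {i} {half k i} (size-left k i) r≤1 eq 2i²≤k)

    right-balanced : ∀ {i} → 2 * (i * i) ≤ k → Bal (right k i)
    right-balanced {i} 2i²≤k = let r , r≤1 , eq = n*-term-spec {k} {i} 2i²≤k in
      balanced {k} {K} 2k≡1+K {i} {half k i} (size-right k i) r≤1
        (trans (cong (λ s → s + 2 * (i * i) + r) (size-right k i)) eq) 2i²≤k

    blocks-balanced : ∀ i → 2 * (i * i) ≤ k → All Bal (blocks k i)
    blocks-balanced zero    h = left-balanced {0} h ∷ []
    blocks-balanced (suc i) h = left-balanced {suc i} h ∷
      All.∷ʳ⁺ (blocks-balanced i (square-mono (ℕ.n≤1+n i) h)) (right-balanced {suc i} h)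

    left-blocks : ∀ i {j} → i ℕ.< j → 2 * (j * j) ≤ k → All (Comp (left k j)) (blocks k i)
    left-blocks zero    {j} i<j h = left-left {0} {j} i<j z≤n h ∷ []
    left-blocks (suc i) {j} i<j h = left-left {suc i} {j} i<j (square-mono (ℕ.<⇒≤ i<j) h) h ∷
      All.∷ʳ⁺ (left-blocks i (ℕ.<-trans (ℕ.n<1+n i) i<j) h) (left-right (suc i) {j} (ℕ.≤-<-trans z≤n i<j) h)

    blocks-right : ∀ i {j} → i ℕ.< j → 2 * (j * j) ≤ k → All (λ β → Comp β (right k j)) (blocks k i)
    -- `flip (right k 0)` computes to `left k 0`, so the pair L_0, R_j is the mirror image of the
    -- pair `left k j`, `right k 0`.
    blocks-right zero    {j} i<j h = compatible-flip k (2 * K) (left k j) (right k 0) (left-right 0 {j} i<j h) ∷ []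
    blocks-right (suc i) {j} i<j h =
      compatible-flip k (2 * K) (left k j) (right k (suc i)) (left-right (suc i) {j} (ℕ.≤-<-trans z≤n i<j) h) ∷
      All.∷ʳ⁺ (blocks-right i (ℕ.<-trans (ℕ.n<1+n i) i<j) h)
        (compatible-flip k (2 * K) (left k j) (left k (suc i)) (left-left {suc i} {j} i<j (square-mono (ℕ.<⇒≤ i<j) h) h))

    blocks-compatible : ∀ i → 2 * (i * i) ≤ k → AllPairs Comp (blocks k i)
    blocks-compatible zero    h = [] ∷ []
    blocks-compatible (suc i) h =
      All.∷ʳ⁺ (left-blocks i (ℕ.n<1+n i) h) (left-right (suc i) {suc i} (s≤s z≤n) h) ∷
      AllPairs.++⁺ (blocks-compatible i (square-mono (ℕ.n≤1+n i) h)) ([] ∷ [])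
        (All.map (_∷ []) (blocks-right i (ℕ.n<1+n i) h))

  -- The number of levels and its growth.

  width-blocks : ∀ k i → width (blocks k i) ≡ 2 * k + 2 * sum (applyUpTo (λ j → n*-term k (suc j)) i)
  width-blocks k zero    = cong (_+ 0) (begin
    size (left k 0)       ≡⟨ size-left k 0 ⟩
    2 * (2 * k / 2) + 0   ≡⟨ ℕ.+-identityʳ _ ⟩
    2 * (2 * k / 2)       ≡⟨ cong (λ x → 2 * (x / 2)) (ℕ.*-comm 2 k) ⟩
    2 * (k * 2 / 2)       ≡⟨ cong (2 *_) (ℕ.m*n/n≡m k 2) ⟩
    2 * k                 ∎)
    where open ≡-Reasoning
  width-blocks k (suc i) = begin
    size (left k (suc i)) + width (blocks k i ∷ʳ right k (suc i))
      ≡⟨ cong₂ _+_ (size-left k (suc i)) (trans (cong sum (List.map-++ size (blocks k i) _)) (sum-++ (map size (blocks k i)) _)) ⟩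
    t + (width (blocks k i) + (size (right k (suc i)) + 0))
      ≡⟨ cong₂ (λ w s → t + (w + (s + 0))) (width-blocks k i) (size-right k (suc i)) ⟩
    t + (2 * k + 2 * Σ + (t + 0))
      ≡⟨ e t (2 * k) Σ ⟩
    2 * k + 2 * (Σ + (t + 0))
      ≡⟨ cong (λ x → 2 * k + 2 * x) (sum-++ (applyUpTo f i) (t ∷ [])) ⟨
    2 * k + 2 * sum (applyUpTo f i ∷ʳ t)
      ≡⟨ cong (λ x → 2 * k + 2 * sum x) (List.applyUpTo-∷ʳ f i) ⟩
    2 * k + 2 * sum (applyUpTo f (suc i)) ∎
    where
    open ≡-Reasoning
    f : ℕ → ℕ
    f j = n*-term k (suc j)
    t = n*-term k (suc i)
    Σ = sum (applyUpTo f i)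
    e : ∀ t x Σ → t + (x + 2 * Σ + (t + 0)) ≡ x + 2 * (Σ + (t + 0))
    e = solve-∀

  √-spec : ∀ k → 2 * (⌊√ k /2⌋ * ⌊√ k /2⌋) ≤ k
  √-spec k = subst (λ x → 2 * x ≤ k) (^2-≡ ⌊√ k /2⌋) (greatest-holds (λ m → 2 * m ^ 2 ℕ.≤? k) z≤n k)

  √-max : ∀ k → k ℕ.< 2 * (suc ⌊√ k /2⌋ * suc ⌊√ k /2⌋)
  √-max k = ℕ.≰⇒> λ h → ℕ.<-irrefl refl (greatest-max (λ m → 2 * m ^ 2 ℕ.≤? k) k
    (subst (λ x → 2 * x ≤ k) (sym (^2-≡ (suc ⌊√ k /2⌋))) h)
    (ℕ.≤-trans (n≤n² (suc ⌊√ k /2⌋)) (ℕ.≤-trans (ℕ.m≤n*m _ 2) h)))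

  sum-≥ : ∀ (f : ℕ → ℕ) c n → (∀ i → i ℕ.< n → c ≤ f i) → n * c ≤ sum (applyUpTo f n)
  sum-≥ f c zero    c≤f = z≤n
  sum-≥ f c (suc n) c≤f = ℕ.+-mono-≤ (c≤f 0 (s≤s z≤n)) (sum-≥ (f ∘ suc) c n (λ i i<n → c≤f (suc i) (s≤s i<n)))

  -- Let m = ⌊√(k/2)⌋. Each of the m terms is at least 2k - 2i² - 1 ≥ k - 1, so n* ≥ 2(m + 1)(k -
  -- 1). Squaring, 2(m + 1)² > k and 2(k - 1)² ≥ k² give the claim.
  k³≤n*² : ∀ {k} → 7 ≤ k → k ^ 3 ≤ n* k ^ 2
  k³≤n*² {k@(suc k′)} (s≤s 6≤k′) = begin
    k ^ 3                               ≡⟨ e₁ k ⟩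
    k * (k * k)                         ≤⟨ ℕ.*-monoʳ-≤ k k²≤2k′² ⟩
    k * (2 * (k′ * k′))                 ≤⟨ ℕ.*-monoˡ-≤ (2 * (k′ * k′)) (ℕ.<⇒≤ (√-max k)) ⟩
    2 * (suc m * suc m) * (2 * (k′ * k′))   ≡⟨ e₂ (suc m) k′ ⟩
    (2 * (suc m * k′)) * (2 * (suc m * k′))   ≤⟨ ℕ.*-mono-≤ lower lower ⟩
    n* k * n* k                         ≡⟨ ^2-≡ (n* k) ⟨
    n* k ^ 2                            ∎
    where
    open ℕ.≤-Reasoning
    m = ⌊√ k /2⌋
    e₁ : ∀ k → k * (k * (k * 1)) ≡ k * (k * k)
    e₁ = solve-∀
    e₂ : ∀ m k → 2 * (m * m) * (2 * (k * k)) ≡ (2 * (m * k)) * (2 * (m * k))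
    e₂ = solve-∀
    e₃ : ∀ k′ → suc k′ * suc k′ ≡ k′ * k′ + (2 * k′ + 1)
    e₃ = solve-∀
    k²≤2k′² : k * k ≤ 2 * (k′ * k′)
    k²≤2k′² = begin
      suc k′ * suc k′              ≡⟨ e₃ k′ ⟩
      k′ * k′ + (2 * k′ + 1)       ≤⟨ ℕ.+-monoʳ-≤ (k′ * k′) (ℕ.+-monoʳ-≤ (2 * k′) (ℕ.≤-trans (s≤s z≤n) 6≤k′)) ⟩
      k′ * k′ + (2 * k′ + k′)      ≡⟨ e₄ k′ ⟩
      k′ * k′ + 3 * k′             ≤⟨ ℕ.+-monoʳ-≤ (k′ * k′) (ℕ.*-monoˡ-≤ k′ (ℕ.≤-trans (s≤s (s≤s (s≤s z≤n))) 6≤k′)) ⟩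
      k′ * k′ + k′ * k′            ≡⟨ e₅ (k′ * k′) ⟩
      2 * (k′ * k′)                ∎
      where
      e₄ : ∀ k → k * k + (2 * k + k) ≡ k * k + 3 * k
      e₄ = solve-∀
      e₅ : ∀ x → x + x ≡ 2 * x
      e₅ = solve-∀
    term-≥ : ∀ i → i ℕ.< m → k′ ≤ n*-term k (suc i)
    term-≥ i i<m with n*-term-spec {k} {suc i} (square-mono i<m (√-spec k))
    ... | r , r≤1 , eq = ℕ.+-cancelʳ-≤ (k + 1) _ _ (begin
      k′ + (k + 1)                        ≡⟨ e₆ k′ ⟩
      2 * k                               ≡⟨ eq ⟨
      n*-term k (suc i) + 2 * (suc i * suc i) + r   ≤⟨ ℕ.+-mono-≤ (ℕ.+-monoʳ-≤ _ (square-mono i<m (√-spec k))) r≤1 ⟩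
      n*-term k (suc i) + k + 1           ≡⟨ ℕ.+-assoc _ k 1 ⟩
      n*-term k (suc i) + (k + 1)         ∎)
      where
      e₆ : ∀ k′ → k′ + (suc k′ + 1) ≡ 2 * suc k′
      e₆ = solve-∀
    lower : 2 * (suc m * k′) ≤ n* k
    lower = begin
      2 * (suc m * k′)                    ≡⟨ ℕ.*-distribˡ-+ 2 k′ (m * k′) ⟩
      2 * k′ + 2 * (m * k′)               ≤⟨ ℕ.+-mono-≤ (ℕ.*-monoʳ-≤ 2 (ℕ.n≤1+n k′)) (ℕ.*-monoʳ-≤ 2 (sum-≥ _ k′ m term-≥)) ⟩
      n* k                                ∎

open Levels
open import Defs
open import Data.Integer.Base using (+_)

-- Heights in an acyclic digraph

Linked-prefix : ∀ {R : A → A → Set} {x} ys {y zs} → Linked R (x ∷ ys ++ y ∷ zs) → Linked R (x ∷ ys ∷ʳ y)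
Linked-prefix []       (r ∷ _)  = r ∷ [-]
Linked-prefix (_ ∷ ys) (r ∷ rs) = r ∷ Linked-prefix ys rs

Unique-prefix : ∀ ys {y : A} {zs} → Unique (ys ++ y ∷ zs) → Unique (y ∷ ys)
Unique-prefix []       _          = [] ∷ []
Unique-prefix (x ∷ ys) (x∉ ∷ uniq) with Unique-prefix ys uniq | All.++⁻ ys x∉
... | y∉ys ∷ uniq-ys | x∉ys , x≢y ∷ _ = ((λ y≡x → x≢y (sym y≡x)) ∷ y∉ys) ∷ (x∉ys ∷ uniq-ys)

module _ (D : WeightedDigraph) where
  open WeightedDigraph D

  -- The tail of the walk is a path by induction. If its first vertex `v` occurred again, the
  -- stretch up to that occurrence would be a directed cycle.
  acyclic⇒unique : Acyclic D → ∀ {vs} → Linked (Arc D) vs → Unique vs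
  acyclic⇒unique acyclic {[]}     _      = []
  acyclic⇒unique acyclic {v ∷ vs} linked with acyclic⇒unique acyclic (Linked.tail linked) | Any.any? (v Fin.≟_) vs
  ... | uniq | no v∉vs  = All.¬Any⇒All¬ vs v∉vs ∷ uniq
  ... | uniq | yes v∈vs with ∈-∃++ v∈vs
  ...   | ys , zs , refl = ⊥-elim (acyclic v ys (Linked-prefix ys linked , Unique-prefix ys uniq))

  Walk : ℕ → Fin order → Set
  Walk zero    v = ⊤
  Walk (suc t) v = ∃[ u ] Arc D v u × Walk t u

  walk? : ∀ t v → Dec (Walk t v)
  walk? zero    v = yes tt
  walk? (suc t) v = Fin.any? λ u → T? (arc v u) ×-dec walk? t u

  walk⇒linked : ∀ t v → Walk t v → ∃[ vs ] length vs ≡ t × Linked (Arc D) (v ∷ vs)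
  walk⇒linked zero    v _             = [] , refl , [-]
  walk⇒linked (suc t) v (u , a , walk) with walk⇒linked t u walk
  ... | vs , len , linked = u ∷ vs , cong suc len , a ∷ linked

  module _ (acyclic : Acyclic D) {n : ℕ} (longest : LongestPathOrder D n) where

    -- `t` counts arcs, so the walk has t + 1 vertices, and by acyclicity it is a path. Hence the
    -- search bound `n` in `height` misses no walk.
    walk⇒< : ∀ t v → Walk t v → t ℕ.< n
    walk⇒< t v walk with walk⇒linked t v walk
    ... | vs , refl , linked = proj₂ longest (v ∷ vs) (linked , acyclic⇒unique acyclic linked)

    height : Fin order → ℕ
    height v = greatest (λ t → walk? t v) n

    height-walk : ∀ v → Walk (height v) v
    height-walk v = greatest-holds (λ t → walk? t v) tt n

    height<n : ∀ v → height v ℕ.< n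
    height<n v = walk⇒< (height v) v (height-walk v)

    -- Prepending the arc to a longest walk from `v` yields a walk from `u` with one more arc.
    height-arc : ∀ {u v} → Arc D u v → height v ℕ.< height u
    height-arc {u} {v} a = greatest-max (λ t → walk? t u) n (v , a , height-walk v) (height<n v)

-- The average cut

≤-+-0≤ : ∀ {x y} → 0ℚ ℚ.≤ y → x ℚ.≤ x ℚ.+ y
≤-+-0≤ {x} {y} 0≤y = ℚ.≤-trans (ℚ.≤-reflexive (sym (ℚ.+-identityʳ x))) (ℚ.+-monoʳ-≤ x 0≤y)

0≤0ℝ : 0ℝ ≤ 0ℝ
0≤0ℝ ε 0<ε = 0 , λ _ _ → ≤-+-0≤ (ℚ.<⇒≤ 0<ε)

0≤-+ : ∀ {x y} → 0ℝ ≤ x → 0ℝ ≤ y → 0ℝ ≤ x + y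
0≤-+ {x} {y} 0≤x 0≤y ε 0<ε with 0≤x (½ ℚ.* ε) (half-pos 0<ε) | 0≤y (½ ℚ.* ε) (half-pos 0<ε)
... | M , hx | N , hy = M ℕ.⊔ N , λ n M⊔N≤n → begin
  0ℚ ℚ.+ 0ℚ
    ≤⟨ ℚ.+-mono-≤ (hx n (ℕ.m⊔n≤o⇒m≤o M N M⊔N≤n)) (hy n (ℕ.m⊔n≤o⇒n≤o M N M⊔N≤n)) ⟩
  seq x n ℚ.+ ½ ℚ.* ε ℚ.+ (seq y n ℚ.+ ½ ℚ.* ε)
    ≡⟨ solve 3 (λ a b e → a :+ e :+ (b :+ e) := a :+ b :+ (e :+ e)) refl (seq x n) (seq y n) (½ ℚ.* ε) ⟩
  seq x n ℚ.+ seq y n ℚ.+ (½ ℚ.* ε ℚ.+ ½ ℚ.* ε)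
    ≡⟨ cong (seq x n ℚ.+ seq y n ℚ.+_) (half-sum ε) ⟩
  seq x n ℚ.+ seq y n ℚ.+ ε ∎
  where
  open ℚ.≤-Reasoning
  open +-*-Solver

0≤-∑ : ∀ {n} (f : Fin n → ℝ) → (∀ i → 0ℝ ≤ f i) → 0ℝ ≤ ∑ f
0≤-∑ {zero}  f 0≤f = 0≤0ℝ
0≤-∑ {suc n} f 0≤f = 0≤-+ {f Fin.zero} {∑ (f ∘ Fin.suc)} (0≤f Fin.zero) (0≤-∑ (f ∘ Fin.suc) (0≤f ∘ Fin.suc))

0≤-* : ∀ {a x} → 0ℚ ℚ.≤ a → 0ℝ ≤ x → 0ℝ ≤ fromℚ a * x
0≤-* {a} {x} 0≤a 0≤x ε 0<ε = let N , h = 0≤x δ 0<δ in N , λ n N≤n → begin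
  0ℚ                                     ≡⟨ ℚ.*-zeroʳ a ⟨
  a ℚ.* 0ℚ                               ≤⟨ ℚ.*-monoˡ-≤-nonNeg a {{ℚ.nonNegative 0≤a}} (h n N≤n) ⟩
  a ℚ.* (seq x n ℚ.+ δ)                  ≤⟨ ≤-+-0≤ (ℚ.<⇒≤ 0<δ) ⟩
  a ℚ.* (seq x n ℚ.+ δ) ℚ.+ δ            ≡⟨ solve 4 (λ a y e i → a :* (y :+ e :* i) :+ e :* i :=
                                                                  a :* y :+ e :* ((con 1ℚ :+ a) :* i)) refl
                                              a (seq x n) ε (inv 1+a) ⟩
  a ℚ.* seq x n ℚ.+ ε ℚ.* (1+a ℚ.* inv 1+a)  ≡⟨ cong (λ t → a ℚ.* seq x n ℚ.+ ε ℚ.* t) (inv-cancel 0<1+a) ⟩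
  a ℚ.* seq x n ℚ.+ ε ℚ.* 1ℚ             ≡⟨ cong (a ℚ.* seq x n ℚ.+_) (ℚ.*-identityʳ ε) ⟩
  a ℚ.* seq x n ℚ.+ ε                    ∎
  where
  open ℚ.≤-Reasoning
  open +-*-Solver
  1+a = 1ℚ ℚ.+ a
  0<1+a : 0ℚ ℚ.< 1+a
  0<1+a = ℚ.<-≤-trans 0<1 (≤-+-0≤ 0≤a)
  -- Chosen so that aδ + δ = ε; dividing by 1 + a covers a = 0 as well.
  δ = ε ℚ.* inv 1+a
  0<δ : 0ℚ ℚ.< δ
  0<δ = pos* 0<ε (inv-pos 0<1+a)

-- The sign condition on `a` is guarded by `T b` because cut frequencies are bounded below on arcs
-- only; off the arcs the weight is 0.
0≤-*-extendByZero : ∀ {a} b (w : T b → ℝ) → (T b → 0ℚ ℚ.≤ a) → (∀ t → 0ℝ ≤ w t) →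
  0ℝ ≤ fromℚ a * extendByZero b w
0≤-*-extendByZero {a} true  w 0≤a 0≤w = 0≤-* {a} {w tt} (0≤a tt) (0≤w tt)
0≤-*-extendByZero {a} false w 0≤a 0≤w ε 0<ε = 0 , λ _ _ → begin
  0ℚ                     ≤⟨ ℚ.<⇒≤ 0<ε ⟩
  ε                      ≡⟨ ℚ.+-identityˡ ε ⟨
  0ℚ ℚ.+ ε               ≡⟨ cong (ℚ._+ ε) (ℚ.*-zeroʳ a) ⟨
  a ℚ.* 0ℚ ℚ.+ ε         ∎
  where open ℚ.≤-Reasoning

seq-∑ : ∀ {m} (f : Fin m → ℝ) n → seq (∑ f) n ≡ Sum.sum (λ i → seq (f i) n)
seq-∑ {zero}  f n = refl
seq-∑ {suc m} f n = cong (seq (f Fin.zero) n ℚ.+_) (seq-∑ (f ∘ Fin.suc) n)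

∑∑ : ∀ {m} → (Fin m → Fin m → ℚ) → ℚ
∑∑ f = Sum.sum λ u → Sum.sum (f u)

seq-∑∑ : ∀ {m} (f : Fin m → Fin m → ℝ) n → seq (∑ λ u → ∑ (f u)) n ≡ ∑∑ (λ u v → seq (f u v) n)
seq-∑∑ f n = trans (seq-∑ (λ u → ∑ (f u)) n) (sum-cong-≗ (λ u → seq-∑ (f u) n))

∑∑-cong : ∀ {m} {f g : Fin m → Fin m → ℚ} → (∀ u v → f u v ≡ g u v) → ∑∑ f ≡ ∑∑ g
∑∑-cong f≗g = sum-cong-≗ (λ u → sum-cong-≗ (f≗g u))

∑∑-+ : ∀ {m} (f g : Fin m → Fin m → ℚ) → ∑∑ (λ u v → f u v ℚ.+ g u v) ≡ ∑∑ f ℚ.+ ∑∑ g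
∑∑-+ f g = trans (sum-cong-≗ (λ u → ∑-distrib-+ (f u) (g u))) (∑-distrib-+ (λ u → Sum.sum (f u)) (λ u → Sum.sum (g u)))

∑∑-*ˡ : ∀ {m} c (f : Fin m → Fin m → ℚ) → ∑∑ (λ u v → c ℚ.* f u v) ≡ c ℚ.* ∑∑ f
∑∑-*ˡ c f = sym (trans (*-distribˡ-sum c (λ u → Sum.sum (f u))) (sum-cong-≗ (λ u → *-distribˡ-sum c (f u))))

≤-maxSubset : ∀ {m} (f : Subset m → ℝ) n X → seq (f X) n ℚ.≤ seq (maxSubset m f) n
≤-maxSubset {zero}  f n []          = ℚ.≤-refl
≤-maxSubset {suc m} f n (true ∷ X)  = ℚ.≤-trans (≤-maxSubset (f ∘ (inside ∷_)) n X)
  (ℚ.p≤p⊔q (seq (maxSubset m (f ∘ (inside ∷_))) n) (seq (maxSubset m (f ∘ (outside ∷_))) n))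
≤-maxSubset {suc m} f n (false ∷ X) = ℚ.≤-trans (≤-maxSubset (f ∘ (outside ∷_)) n X)
  (ℚ.p≤q⊔p (seq (maxSubset m (f ∘ (inside ∷_))) n) (seq (maxSubset m (f ∘ (outside ∷_))) n))

frac-0 : ∀ j → frac 0 j ≡ 0ℚ
frac-0 j = ℚ.≤-antisym (frac-≤ 0 j 0 0 z≤n) (frac-≤ 0 0 0 j z≤n)

frac-+ : ∀ a b j → frac (a ℕ.+ b) j ≡ frac a j ℚ.+ frac b j
frac-+ zero    b j = sym (trans (cong (ℚ._+ frac b j) (frac-0 j)) (ℚ.+-identityˡ (frac b j)))
frac-+ (suc a) b j = begin
  frac (suc (a ℕ.+ b)) j                    ≡⟨ frac-suc (a ℕ.+ b) j ⟩
  frac (a ℕ.+ b) j ℚ.+ frac 1 j             ≡⟨ cong (ℚ._+ frac 1 j) (frac-+ a b j) ⟩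
  frac a j ℚ.+ frac b j ℚ.+ frac 1 j        ≡⟨ solve 3 (λ x y z → x :+ y :+ z := x :+ z :+ y) refl (frac a j) (frac b j) (frac 1 j) ⟩
  frac a j ℚ.+ frac 1 j ℚ.+ frac b j        ≡⟨ cong (ℚ._+ frac b j) (frac-suc a j) ⟨
  frac (suc a) j ℚ.+ frac b j               ∎
  where
  open ≡-Reasoning
  open +-*-Solver

0≤frac : ∀ a j → 0ℚ ℚ.≤ frac a j
0≤frac a j = ℚ.≤-trans (ℚ.≤-reflexive (sym (frac-0 j))) (frac-≤ 0 j a j z≤n)

frac-full : ∀ j → frac (suc j) j ≡ 1ℚ
frac-full j = ℚ.≤-antisym (frac-≤ (suc j) j 1 0 (ℕ.≤-reflexive (ℕ.*-comm (suc j) 1)))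
                          (frac-≤ 1 0 (suc j) j (ℕ.≤-reflexive (ℕ.*-comm 1 (suc j))))

module _ (D : WeightedDigraph) {A : Set} (cut : A → Subset (WeightedDigraph.order D)) where
  open WeightedDigraph D

  cuts : List A → Fin order → Fin order → ℕ
  cuts xs u v = ∫ xs (λ x → 𝟙 (lookup (cut x) u ∧ lookup (∁ (cut x)) v))

  -- Each listed cut weighs at most `mac D`; summing over the list and collecting by arcs gives the
  -- claim. It is stated for the n-th rational approximations, so that all sums are taken in ℚ, and
  -- with a common denominator j + 1, later set to the total mass.
  averaging : ∀ xs j n →
    ∑∑ (λ u v → frac (cuts xs u v) j ℚ.* seq (arcWeight D u v) n) ℚ.≤
    frac (∫ xs (const 1)) j ℚ.* seq (mac D) n
  averaging [] j n = ℚ.≤-reflexive (begin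
    ∑∑ (λ u v → frac 0 j ℚ.* w u v)      ≡⟨ ∑∑-*ˡ (frac 0 j) w ⟩
    frac 0 j ℚ.* ∑∑ w                    ≡⟨ cong (ℚ._* ∑∑ w) (frac-0 j) ⟩
    0ℚ ℚ.* ∑∑ w                          ≡⟨ ℚ.*-zeroˡ (∑∑ w) ⟩
    0ℚ                                   ≡⟨ ℚ.*-zeroˡ (seq (mac D) n) ⟨
    0ℚ ℚ.* seq (mac D) n                 ≡⟨ cong (ℚ._* seq (mac D) n) (frac-0 j) ⟨
    frac 0 j ℚ.* seq (mac D) n           ∎)
    where
    open ≡-Reasoning
    w : Fin order → Fin order → ℚ
    w u v = seq (arcWeight D u v) n
  averaging (x ∷ xs) j n = begin
    ∑∑ (λ u v → frac (𝟙 (b u v) ℕ.+ cuts xs u v) j ℚ.* w u v)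
      ≡⟨ ∑∑-cong (λ u v → trans (cong (ℚ._* w u v) (frac-+ (𝟙 (b u v)) (cuts xs u v) j))
                   (trans (ℚ.*-distribʳ-+ (w u v) (frac (𝟙 (b u v)) j) (frac (cuts xs u v) j))
                     (cong (ℚ._+ rest u v) (indicator (b u v) (arcWeight D u v))))) ⟩
    ∑∑ (λ u v → frac 1 j ℚ.* crossing u v ℚ.+ rest u v)
      ≡⟨ trans (∑∑-+ (λ u v → frac 1 j ℚ.* crossing u v) rest) (cong (ℚ._+ ∑∑ rest) (∑∑-*ˡ (frac 1 j) crossing)) ⟩
    frac 1 j ℚ.* ∑∑ crossing ℚ.+ ∑∑ rest
      ≡⟨ cong (λ t → frac 1 j ℚ.* t ℚ.+ ∑∑ rest) (seq-∑∑ cross n) ⟨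
    frac 1 j ℚ.* seq (weightBetween D (cut x) (∁ (cut x))) n ℚ.+ ∑∑ rest
      ≤⟨ ℚ.+-mono-≤ (ℚ.*-monoˡ-≤-nonNeg (frac 1 j) {{ℚ.nonNegative (0≤frac 1 j)}}
           (≤-maxSubset (λ X → weightBetween D X (∁ X)) n (cut x))) (averaging xs j n) ⟩
    frac 1 j ℚ.* M ℚ.+ frac (∫ xs (const 1)) j ℚ.* M
      ≡⟨ ℚ.*-distribʳ-+ M (frac 1 j) _ ⟨
    (frac 1 j ℚ.+ frac (∫ xs (const 1)) j) ℚ.* M
      ≡⟨ cong (ℚ._* M) (frac-+ 1 (∫ xs (const 1)) j) ⟨
    frac (1 ℕ.+ ∫ xs (const 1)) j ℚ.* M ∎
    where
    open ℚ.≤-Reasoning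
    M = seq (mac D) n
    b : Fin order → Fin order → Bool
    b u v = lookup (cut x) u ∧ lookup (∁ (cut x)) v
    cross : Fin order → Fin order → ℝ
    cross u v = if b u v then arcWeight D u v else 0ℝ
    w rest crossing : Fin order → Fin order → ℚ
    w u v = seq (arcWeight D u v) n
    rest u v = frac (cuts xs u v) j ℚ.* w u v
    crossing u v = seq (cross u v) n
    indicator : ∀ b y → frac (𝟙 b) j ℚ.* seq y n ≡ frac 1 j ℚ.* seq (if b then y else 0ℝ) n
    indicator true  y = refl
    indicator false y = trans (cong (ℚ._* seq y n) (frac-0 j)) (trans (ℚ.*-zeroˡ (seq y n)) (sym (ℚ.*-zeroʳ (frac 1 j))))

  -- The average cut minus p / (q + 1) times the total weight is the sum of the terms `slack`, each
  -- nonnegative by the frequency hypothesis. Nonnegativity of this single sum supplies the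
  -- threshold N for ε.
  frequent-cuts⇒mac : ∀ xs p q j → ∫ xs (const 1) ≡ suc j →
    (∀ {u v} → Arc D u v → p ℕ.* suc j ℕ.≤ suc q ℕ.* cuts xs u v) →
    fromℚ (frac p q) * totalWeight D ≤ mac D
  frequent-cuts⇒mac xs p q j mass≡ frequent ε 0<ε =
    let N , h = slack≥0 ε 0<ε in N , λ n N≤n → begin
    r ℚ.* seq (totalWeight D) n
      ≡⟨ ℚ.+-identityʳ _ ⟨
    r ℚ.* seq (totalWeight D) n ℚ.+ 0ℚ
      ≤⟨ ℚ.+-monoʳ-≤ (r ℚ.* seq (totalWeight D) n) (h n N≤n) ⟩
    r ℚ.* seq (totalWeight D) n ℚ.+ (seq (∑ λ u → ∑ (slack u)) n ℚ.+ ε)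
      ≡⟨ ℚ.+-assoc (r ℚ.* seq (totalWeight D) n) _ ε ⟨
    r ℚ.* seq (totalWeight D) n ℚ.+ seq (∑ λ u → ∑ (slack u)) n ℚ.+ ε
      ≡⟨ cong (ℚ._+ ε) (split n) ⟩
    ∑∑ (λ u v → P u v ℚ.* seq (arcWeight D u v) n) ℚ.+ ε
      ≤⟨ ℚ.+-monoˡ-≤ ε (averaging xs j n) ⟩
    frac (∫ xs (const 1)) j ℚ.* seq (mac D) n ℚ.+ ε
      ≡⟨ cong (λ t → t ℚ.* seq (mac D) n ℚ.+ ε) (trans (cong (λ m → frac m j) mass≡) (frac-full j)) ⟩
    1ℚ ℚ.* seq (mac D) n ℚ.+ ε
      ≡⟨ cong (ℚ._+ ε) (ℚ.*-identityˡ (seq (mac D) n)) ⟩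
    seq (mac D) n ℚ.+ ε ∎
    where
    open ℚ.≤-Reasoning
    r = frac p q
    P : Fin order → Fin order → ℚ
    P u v = frac (cuts xs u v) j
    slack : Fin order → Fin order → ℝ
    slack u v = fromℚ (P u v ℚ.- r) * arcWeight D u v
    r≤P : ∀ {u v} → Arc D u v → 0ℚ ℚ.≤ P u v ℚ.- r
    r≤P {u} {v} a = ℚ.≤-trans (ℚ.≤-reflexive (sym (ℚ.+-inverseʳ r))) (ℚ.+-monoˡ-≤ (ℚ.- r)
      (frac-≤ p q (cuts xs u v) j (ℕ.≤-trans (frequent a) (ℕ.≤-reflexive (ℕ.*-comm (suc q) (cuts xs u v))))))
    slack≥0 : 0ℝ ≤ (∑ λ u → ∑ (slack u))
    slack≥0 = 0≤-∑ (λ u → ∑ (slack u)) λ u → 0≤-∑ (slack u) λ v →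
      0≤-*-extendByZero (arc u v) (weight u v) r≤P (weight≥0 u v)
    split : ∀ n → r ℚ.* seq (totalWeight D) n ℚ.+ seq (∑ λ u → ∑ (slack u)) n ≡
                  ∑∑ (λ u v → P u v ℚ.* seq (arcWeight D u v) n)
    split n = begin-equality
      r ℚ.* seq (totalWeight D) n ℚ.+ seq (∑ λ u → ∑ (slack u)) n
        ≡⟨ cong₂ (λ s t → r ℚ.* s ℚ.+ t) (seq-∑∑ (arcWeight D) n) (seq-∑∑ slack n) ⟩
      r ℚ.* ∑∑ w ℚ.+ ∑∑ (λ u v → (P u v ℚ.- r) ℚ.* w u v)
        ≡⟨ cong (ℚ._+ ∑∑ (λ u v → (P u v ℚ.- r) ℚ.* w u v)) (∑∑-*ˡ r w) ⟨
      ∑∑ (λ u v → r ℚ.* w u v) ℚ.+ ∑∑ (λ u v → (P u v ℚ.- r) ℚ.* w u v)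
        ≡⟨ ∑∑-+ (λ u v → r ℚ.* w u v) (λ u v → (P u v ℚ.- r) ℚ.* w u v) ⟨
      ∑∑ (λ u v → r ℚ.* w u v ℚ.+ (P u v ℚ.- r) ℚ.* w u v)
        ≡⟨ ∑∑-cong (λ u v → solve 3 (λ a b c → a :* c :+ (b :- a) :* c := b :* c) refl r (P u v) (w u v)) ⟩
      ∑∑ (λ u v → P u v ℚ.* w u v) ∎
      where
      open +-*-Solver
      w : Fin order → Fin order → ℚ
      w u v = seq (arcWeight D u v) n

-- Heights are below `width bs` and so serve as levels. An arc from u to v is cut exactly when the
-- sample contains the level of v and misses the higher level of u, so `samples-separation` bounds
-- its frequency.
blocks⇒admissible : ∀ p q bs → All (Balanced p (suc q)) bs → AllPairs (Compatible p (suc q)) bs →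
  Admissible (width bs) (fromℚ (frac p q))
blocks⇒admissible p q bs balanced compatible = nonneg , λ D acyclic longest →
  let open WeightedDigraph D using (order)
      level : Fin order → Fin (width bs)
      level v = fromℕ< (height<n D acyclic longest v)
      -- Arcs go down, so the source side consists of the unsampled levels.
      cut : Vec Bool (width bs) → Subset order
      cut x = tabulate (λ v → not (lookup x (level v)))
      in-cut : ∀ u v x → 𝟙 (lookup (cut x) u ∧ lookup (∁ (cut x)) v) ≡ separates (level v) (level u) x
      in-cut u v x = cong 𝟙 (trans (cong₂ _∧_ (Vec.lookup∘tabulate (λ v → not (lookup x (level v))) u)
        (trans (Vec.lookup-map v not (cut x))
          (trans (cong not (Vec.lookup∘tabulate (λ v → not (lookup x (level v))) v)) (not-involutive _))))
        (∧-comm (not (lookup x (level u))) (lookup x (level v))))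
  in frequent-cuts⇒mac D cut (samples bs) p q (pred (mass bs)) mass≡ λ {u} {v} a →
    subst₂ (λ m c → p ℕ.* m ℕ.≤ suc q ℕ.* c) mass≡ (sym (∫-cong (in-cut u v) (samples bs)))
      (samples-separation p (suc q) bs balanced compatible (level v) (level u)
        (subst₂ ℕ._<_ (sym (Fin.toℕ-fromℕ< (height<n D acyclic longest v)))
                      (sym (Fin.toℕ-fromℕ< (height<n D acyclic longest u)))
          (height-arc D acyclic longest a)))
  where
  mass≡ : mass bs ≡ suc (pred (mass bs))
  mass≡ = sym (ℕ.suc-pred (mass bs) {{ℕ.>-nonZero (mass>0 bs)}})
  nonneg : 0ℝ ≤ fromℚ (frac p q)
  nonneg ε 0<ε = 0 , λ _ _ → ℚ.≤-trans (0≤frac p q) (≤-+-0≤ (ℚ.<⇒≤ 0<ε))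

-- Comparison of k / (4k - 2) with the claimed bound.

frac-* : ∀ a i b j c → a ℕ.* b ≡ c ℕ.* (suc i ℕ.* suc j) → frac a i ℚ.* frac b j ≡ frac c 0
frac-* a i b j c eq = ℚ.toℚᵘ-injective (begin
  ℚ.toℚᵘ (frac a i ℚ.* frac b j)                   ≈⟨ ℚ.toℚᵘ-homo-* (frac a i) (frac b j) ⟩
  ℚ.toℚᵘ (frac a i) ℚᵘ.* ℚ.toℚᵘ (frac b j)         ≈⟨ ℚᵘ.*-cong (frac-≃ a i) (frac-≃ b j) ⟩
  ℚᵘ.mkℚᵘ (+ a) i ℚᵘ.* ℚᵘ.mkℚᵘ (+ b) j             ≈⟨ ℚᵘ.*≡* cross ⟩
  ℚᵘ.mkℚᵘ (+ c) 0                                  ≈⟨ frac-≃ c 0 ⟨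
  ℚ.toℚᵘ (frac c 0)                                ∎)
  where
  open import Relation.Binary.Reasoning.Setoid ℚᵘ.≃-setoid
  cross : (+ a ℤ.* + b) ℤ.* + 1 ≡ + c ℤ.* (+ suc i ℤ.* + suc j)
  cross = trans (ℤ.*-identityʳ (+ a ℤ.* + b)) (trans (sym (ℤ.pos-* a b)) (trans (cong +_ eq)
    (trans (ℤ.pos-* c (suc i ℕ.* suc j)) (cong (+ c ℤ.*_) (ℤ.pos-* (suc i) (suc j))))))

-- k / (4k − 2) − 1 / 4 = 1 / (8k − 4), for q + 1 = 4k − 2
value-inv : ∀ k q → 4 ℕ.* k ≡ suc q ℕ.+ 2 →
  (frac k q ℚ.- + 1 ℚ./ 4) ℚ.* (+ 8 ℚ./ 1 ℚ.* frac k 0 ℚ.- + 4 ℚ./ 1) ≡ 1ℚ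
value-inv k q 4k≡ = begin
  (r ℚ.- + 1 ℚ./ 4) ℚ.* (+ 8 ℚ./ 1 ℚ.* κ ℚ.- + 4 ℚ./ 1)
    ≡⟨ cong (λ d → (r ℚ.- + 1 ℚ./ 4) ℚ.* d) denom ⟩
  (r ℚ.- + 1 ℚ./ 4) ℚ.* (+ 2 ℚ./ 1 ℚ.* m)
    ≡⟨ solve 2 (λ r m → (r :- con (+ 1 ℚ./ 4)) :* (con (+ 2 ℚ./ 1) :* m) := con (+ 2 ℚ./ 1) :* (r :* m) :- con ½ :* m) refl r m ⟩
  + 2 ℚ./ 1 ℚ.* (r ℚ.* m) ℚ.- ½ ℚ.* m
    ≡⟨ cong (λ t → + 2 ℚ./ 1 ℚ.* t ℚ.- ½ ℚ.* m) (frac-* k q (suc q) 0 k (cong (k ℕ.*_) (sym (ℕ.*-identityʳ (suc q))))) ⟩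
  + 2 ℚ./ 1 ℚ.* κ ℚ.- ½ ℚ.* m
    ≡⟨ cong (λ t → + 2 ℚ./ 1 ℚ.* κ ℚ.- ½ ℚ.* t) m≡ ⟩
  + 2 ℚ./ 1 ℚ.* κ ℚ.- ½ ℚ.* (+ 4 ℚ./ 1 ℚ.* κ ℚ.- + 2 ℚ./ 1)
    ≡⟨ solve 1 (λ κ → con (+ 2 ℚ./ 1) :* κ :- con ½ :* (con (+ 4 ℚ./ 1) :* κ :- con (+ 2 ℚ./ 1)) := con 1ℚ) refl κ ⟩
  1ℚ ∎
  where
  open ≡-Reasoning
  open +-*-Solver
  r = frac k q
  κ = frac k 0
  m = frac (suc q) 0
  m≡ : m ≡ + 4 ℚ./ 1 ℚ.* κ ℚ.- + 2 ℚ./ 1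
  m≡ = begin
    m                                        ≡⟨ solve 1 (λ m → m := m :+ con (+ 2 ℚ./ 1) :- con (+ 2 ℚ./ 1)) refl m ⟩
    m ℚ.+ + 2 ℚ./ 1 ℚ.- + 2 ℚ./ 1            ≡⟨ cong (ℚ._- + 2 ℚ./ 1) (frac-+ (suc q) 2 0) ⟨
    frac (suc q ℕ.+ 2) 0 ℚ.- + 2 ℚ./ 1       ≡⟨ cong (λ t → frac t 0 ℚ.- + 2 ℚ./ 1) 4k≡ ⟨
    frac (4 ℕ.* k) 0 ℚ.- + 2 ℚ./ 1           ≡⟨ cong (ℚ._- + 2 ℚ./ 1) (frac-* 4 0 k 0 (4 ℕ.* k) (sym (ℕ.*-identityʳ (4 ℕ.* k)))) ⟨
    + 4 ℚ./ 1 ℚ.* κ ℚ.- + 2 ℚ./ 1            ∎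
  denom : + 8 ℚ./ 1 ℚ.* κ ℚ.- + 4 ℚ./ 1 ≡ + 2 ℚ./ 1 ℚ.* m
  denom = begin
    + 8 ℚ./ 1 ℚ.* κ ℚ.- + 4 ℚ./ 1
      ≡⟨ solve 1 (λ κ → con (+ 8 ℚ./ 1) :* κ :- con (+ 4 ℚ./ 1) := con (+ 2 ℚ./ 1) :* (con (+ 4 ℚ./ 1) :* κ :- con (+ 2 ℚ./ 1))) refl κ ⟩
    + 2 ℚ./ 1 ℚ.* (+ 4 ℚ./ 1 ℚ.* κ ℚ.- + 2 ℚ./ 1)
      ≡⟨ cong (+ 2 ℚ./ 1 ℚ.*_) m≡ ⟨
    + 2 ℚ./ 1 ℚ.* m ∎

inv-unique : ∀ {p q} → 0ℚ ℚ.< q → p ℚ.* q ≡ 1ℚ → inv q ≡ p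
inv-unique {p} {q} 0<q pq≡1 = begin
  inv q                    ≡⟨ ℚ.*-identityˡ (inv q) ⟨
  1ℚ ℚ.* inv q             ≡⟨ cong (ℚ._* inv q) pq≡1 ⟨
  p ℚ.* q ℚ.* inv q        ≡⟨ ℚ.*-assoc p q (inv q) ⟩
  p ℚ.* (q ℚ.* inv q)      ≡⟨ cong (p ℚ.*_) (inv-cancel 0<q) ⟩
  p ℚ.* 1ℚ                 ≡⟨ ℚ.*-identityʳ p ⟩
  p                        ∎
  where open ≡-Reasoning

-- The integer k(j + 1) competes in the maximum defining `⅔-num n j`, since its cube is at most n²(j
-- + 1)³. Thus the inequality holds at every index.
k³≤n²⇒k≤n^⅔ : ∀ {k n} → k ℕ.^ 3 ℕ.≤ n ℕ.^ 2 → ∀ j → frac k 0 ℚ.≤ seq (n ^⅔) j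
k³≤n²⇒k≤n^⅔ {k} {n} k³≤n² j = frac-≤ k 0 (⅔-num n j) j (begin
  k ℕ.* suc j           ≤⟨ ⌊∛⌋-max (n ℕ.^ 2 ℕ.* suc j ℕ.^ 3) (begin
    (k ℕ.* suc j) ℕ.^ 3           ≡⟨ cube-* k (suc j) ⟩
    k ℕ.^ 3 ℕ.* suc j ℕ.^ 3       ≤⟨ ℕ.*-monoˡ-≤ (suc j ℕ.^ 3) k³≤n² ⟩
    n ℕ.^ 2 ℕ.* suc j ℕ.^ 3       ∎) ⟩
  ⅔-num n j             ≡⟨ ℕ.*-identityʳ (⅔-num n j) ⟨
  ⅔-num n j ℕ.* 1       ∎)
  where open ℕ.≤-Reasoning

-- Replacing n^(2/3) by the smaller k lowers the denominator to 8k - 4 and raises the reciprocal; by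
-- `value-inv` the result is exactly k / (4k - 2).
bound-≤ : ∀ {k n} q → 1 ℕ.≤ k → 4 ℕ.* k ≡ suc q ℕ.+ 2 → k ℕ.^ 3 ℕ.≤ n ℕ.^ 2 → (1≤n : 1 ℕ.≤ n) →
  ∀ j → seq (bound n 1≤n) j ℚ.≤ frac k q
bound-≤ {k} {n} q 1≤k 4k≡ k³≤n² 1≤n j = begin
  + 1 ℚ./ 4 ℚ.+ inv (seq (denominator n) j)   ≤⟨ ℚ.+-monoʳ-≤ (+ 1 ℚ./ 4) (inv-anti 0<d
      (ℚ.+-monoˡ-≤ (ℚ.- (+ 4 ℚ./ 1)) (ℚ.*-monoˡ-≤-nonNeg (+ 8 ℚ./ 1) (k³≤n²⇒k≤n^⅔ {k} {n} k³≤n² j)))) ⟩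
  + 1 ℚ./ 4 ℚ.+ inv d                          ≡⟨ cong (+ 1 ℚ./ 4 ℚ.+_) (inv-unique {frac k q ℚ.- + 1 ℚ./ 4} 0<d (value-inv k q 4k≡)) ⟩
  + 1 ℚ./ 4 ℚ.+ (frac k q ℚ.- + 1 ℚ./ 4)       ≡⟨ solve 2 (λ a b → a :+ (b :- a) := b) refl (+ 1 ℚ./ 4) (frac k q) ⟩
  frac k q                                     ∎
  where
  open ℚ.≤-Reasoning
  open +-*-Solver
  d = + 8 ℚ./ 1 ℚ.* frac k 0 ℚ.- + 4 ℚ./ 1
  0<d : 0ℚ ℚ.< d
  0<d = ℚ.<-≤-trans (ℚ.positive⁻¹ (+ 4 ℚ./ 1))
    (ℚ.+-monoˡ-≤ (ℚ.- (+ 4 ℚ./ 1)) (ℚ.*-monoˡ-≤-nonNeg (+ 8 ℚ./ 1) (frac-≤ 1 0 k 0 (ℕ.*-monoˡ-≤ 1 1≤k))))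

mainTheorem14 : (k : ℕ) (7≤k : 7 ℕ.≤ k) (c : ℝ) → IsC (n* k) c →
    bound (n* k) (n*-pos 7≤k) ≤ c
mainTheorem14 k@(suc k′) 7≤k c (upper , _) ε 0<ε =
  -- As an upper bound of the admissible constants, `c` is at least k / (4k - 2). The claimed bound
  -- lies below that at every index, so the same N works.
  let N , h = upper (fromℚ (frac k q)) admissible ε 0<ε
  in N , λ n N≤n → ℚ.≤-trans (bound-≤ {k} {n* k} q (s≤s z≤n) (e₁ k′) (k³≤n*² 7≤k) (n*-pos 7≤k) n) (h n N≤n)
  where
  -- With k = k′ + 1 these are K = 2k - 1 and q + 1 = 4k - 2 = 2K.
  K = suc (2 ℕ.* k′)
  q = suc (4 ℕ.* k′)
  e₁ : ∀ k′ → 4 ℕ.* suc k′ ≡ suc (suc (4 ℕ.* k′)) ℕ.+ 2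
  e₁ = solve-∀
  e₂ : ∀ k′ → 2 ℕ.* suc (2 ℕ.* k′) ≡ suc (suc (4 ℕ.* k′))
  e₂ = solve-∀
  2k≡1+K : 2 ℕ.* k ≡ suc K
  2k≡1+K = ℕ.*-suc 2 k′
  m = ⌊√ k /2⌋
  admissible : Admissible (n* k) (fromℚ (frac k q))
  admissible = subst (λ n → Admissible n (fromℚ (frac k q))) (width-blocks k m)
    (blocks⇒admissible k q (blocks k m)
      (subst (λ Q → All (Balanced k Q) (blocks k m)) (e₂ k′) (blocks-balanced {k} {K} 2k≡1+K m (√-spec k)))
      (subst (λ Q → AllPairs (Compatible k Q) (blocks k m)) (e₂ k′) (blocks-compatible {k} {K} 2k≡1+K m (√-spec k))))
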